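{- Let $G=(V,E)$ be a finite simple graph and let $E=E_1\sqcup E_2$ be a partition of its edge set into two (possibly empty) colour classes. If \[ |E|+\min\{|E_1|,|E_2|\}>\binom{|V|}{2}, \] then $G$ contains a non-monochromatic triangle, i.e. a subgraph isomorphic to $K_3$ containing at least one edge of $E_1$ and at least one edge of $E_2$.
   Context: A triangle in a graph is a subgraph isomorphic to the complete graph $K_3$. A subgraph is monochromatic if all of its edges lie in a single colour class, and non-monochromatic otherwise. -}

module Defs where

open import Data.Nat using (ℕ; _+_; _<_)
open import Data.Nat.Combinatorics using (_C_)
open import Data.Bool using (Bool; true; false; _∨_; _∧_; if_then_else_)
open import Data.Fin using (Fin; toℕ)
open import Data.Fin.Properties using (_<?_)
open import Data.List using (List; []; _∷_; allFin; filter; length; concatMap; map)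
open import Data.Product using (_×_; _,_; Σ; ∃; ∃-syntax; proj₁; proj₂)
open import Data.Sum using (_⊎_)
open import Relation.Nullary using (¬_)
open import Relation.Binary.PropositionalEquality using (_≡_)

record TwoColouredGraph (n : ℕ) : Set where
  field
    E₁ E₂   : Fin n → Fin n → Bool
    sym₁    : ∀ u v → E₁ u v ≡ E₁ v u
    sym₂    : ∀ u v → E₂ u v ≡ E₂ v u
    irrefl₁ : ∀ v → E₁ v v ≡ false
    irrefl₂ : ∀ v → E₂ v v ≡ false
    disjoint : ∀ u v → ¬ (E₁ u v ≡ true × E₂ u v ≡ true)

  E : Fin n → Fin n → Bool
  E u v = E₁ u v ∨ E₂ u v

open TwoColouredGraph public

pairs : (n : ℕ) → List (Fin n × Fin n)
pairs n = concatMap (λ u → map (u ,_) (filter (λ v → u <? v) (allFin n))) (allFin n)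

edgeCount : {n : ℕ} → (Fin n → Fin n → Bool) → ℕ
edgeCount {n} R = length (filter (λ p → R (proj₁ p) (proj₂ p) Data.Bool.≟ true) (pairs n))

min : ℕ → ℕ → ℕ
min = Data.Nat._⊓_

-- a triangle: three pairwise-adjacent vertices (pairwise distinct by
-- irreflexivity); it is non-monochromatic if among its three edges at
-- least one lies in E₁ and at least one lies in E₂
NonMonoTriangle : {n : ℕ} → TwoColouredGraph n → Set
NonMonoTriangle {n} G =
  ∃[ a ] ∃[ b ] ∃[ c ]
    ( E G a b ≡ true × E G b c ≡ true × E G a c ≡ true
    × (E₁ G a b ∨ E₁ G b c ∨ E₁ G a c) ≡ true
    × (E₂ G a b ∨ E₂ G b c ∨ E₂ G a c) ≡ true )

{-# OPTIONS --safe #-}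
module Submission where

-- Colour the non-edges and the loops white; suppose that there is no
-- non-monochromatic triangle. We show that red or blue is at most as frequent
-- as white, by induction on the number n of vertices. If some vertex has at most
-- as many red and at most as many blue as white neighbours, delete it. Otherwise
-- take P maximising |P| - |N(P)| in the red graph, with |P| minimal: Hall's theorem
-- gives a permutation π with v π(v) red or v = π(v) ∈ P for all v, and minimality
-- gives every vertex of P at least as many white as red neighbours. Let σ, P′ be
-- the same for blue, and F, F′ the sets of fixed points; irreducibility makes F′
-- and P disjoint. A red pair v π(v) and a blue pair u σ(u) have at least two white
-- pairs between them, so 2 |W ∩ (V∖F × V∖F′)| ≥ |V∖F| |V∖F′|. Say |F′| ≤ |F|. Adding
-- up, red exceeds white by at most what the red pairs at F and F′ contribute; these
-- are few, since F sees red only in N(P) and σ halves the red degree of any vertex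
-- towards V∖F′.
open import Defs
open import Data.Nat using (ℕ; _+_; _>_)
open import Data.Nat.Combinatorics using (_C_)

open import Data.Bool using (Bool; true; false; _∧_; _∨_; not; if_then_else_)
open import Data.Bool.Properties using () renaming (_≟_ to _≟ᵇ_)
open import Data.Empty using (⊥-elim)
open import Data.Fin using (Fin; zero; suc; punchIn; punchOut)
open import Data.Fin.Properties using (_≟_; any?; punchIn-punchOut; punchOut-injective; punchInᵢ≢i; suc-injective) renaming (_<?_ to _<ᶠ?_; <-cmp to <ᶠ-cmp)
open import Data.List as List using (List; length; filter; concatMap; tabulate)
open import Data.List.Properties using (filter-++; length-++)
open import Data.Nat using (zero; suc; _*_; _≤_; _<_; z≤n; s≤s; _≤?_; _<?_)
open import Data.Nat.Combinatorics using (nC1≡n; nCk+nC[k+1]≡[n+1]C[k+1])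
open import Data.Nat.Properties hiding (_≟_; suc-injective)
open import Algebra.Properties.Semiring.Sum +-*-semiring using (sum; sum-cong-≗; ∑-distrib-+; ∑-comm; sum-remove; sum-replicate-zero; *-distribˡ-sum)
open import Data.Nat.Tactic.RingSolver using (solve-∀)
open import Data.Product using (Σ; _×_; _,_; proj₁; proj₂; ∃)
open import Data.Sum using (_⊎_; inj₁; inj₂)
open import Data.Unit using (tt)
open import Data.Vec.Functional using (_∷_)
open import Function using (_∘_; flip)
open import Relation.Binary.Definitions using (tri<; tri≈; tri>)
open import Relation.Binary.PropositionalEquality using (_≡_; _≢_; _≗_; refl; sym; trans; cong; cong₂; subst; subst₂; module ≡-Reasoning)
open import Relation.Nullary using (¬_; Dec; yes; no; does; contradiction)
open import Relation.Nullary.Decidable using (dec-true; dec-false; _×-dec_)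
open import Relation.Unary using (Decidable)

-- The hypothesis says that both colour classes outnumber the non-edges, so it is enough to refute
-- this for one colour. If `σ` moved every vertex, this would be immediate: sending a red pair `u v`
-- to `u (σ v)` is injective and lands in white. The obstacle is that a permutation along blue pairs
-- need not exist. Hall's theorem localises the failure: the fixed points can be confined to an
-- extremal violator, and their number is exactly |P′| - |N(P′)|. When both colours fail in this
-- way, the pairs that a single shift cannot handle are recovered from the squares built with `π`
-- and `σ` together, and the red pairs left over sit at fixed points, where the structure of the
-- violator bounds them. The roles of the colours are decided only by comparing the numbers of fixed
-- points, so a vertex may be deleted only if it is harmless for both.

private variable
  m n : ℕ

-- Finite sums of natural numbers

opaque
  ∑ : (Fin n → ℕ) → ℕ
  ∑ = sum

  ∑-cong : {f g : Fin n → ℕ} → f ≗ g → ∑ f ≡ ∑ g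
  ∑-cong = sum-cong-≗

  ∑-+ : (f g : Fin n → ℕ) → ∑ (λ i → f i + g i) ≡ ∑ f + ∑ g
  ∑-+ = ∑-distrib-+

  ∑-swap : (f : Fin m → Fin n → ℕ) → ∑ (λ i → ∑ (f i)) ≡ ∑ (λ j → ∑ (flip f j))
  ∑-swap = ∑-comm

  ∑-*ˡ : ∀ k (f : Fin n → ℕ) → ∑ (λ i → k * f i) ≡ k * ∑ f
  ∑-*ˡ k f = sym (*-distribˡ-sum k f)

  ∑-remove : ∀ i (f : Fin (suc n) → ℕ) → ∑ f ≡ f i + ∑ (f ∘ punchIn i)
  ∑-remove i f = sum-remove {i = i} f

  ∑-mono : {f g : Fin n → ℕ} → (∀ i → f i ≤ g i) → ∑ f ≤ ∑ g
  ∑-mono {zero}  f≤g = z≤n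
  ∑-mono {suc n} f≤g = +-mono-≤ (f≤g zero) (∑-mono (f≤g ∘ suc))

  ∑-zero : ∀ n → ∑ {n} (λ _ → 0) ≡ 0
  ∑-zero = sum-replicate-zero

  ∑-one : ∀ n → ∑ {n} (λ _ → 1) ≡ n
  ∑-one zero    = refl
  ∑-one (suc n) = cong suc (∑-one n)

  -- Injectivity is enough on a finite set: the induction removes `zero` from the domain and its
  -- image `π zero` from the codomain.
  ∑-injective : (π : Fin n → Fin n) → (∀ {i j} → π i ≡ π j → i ≡ j) →
    (f : Fin n → ℕ) → ∑ (f ∘ π) ≡ ∑ f
  ∑-injective {zero}  π π-inj f = refl
  ∑-injective {suc n} π π-inj f = trans
    (cong (f (π zero) +_) (trans
      (∑-cong (λ i → cong f (sym (punchIn-punchOut (π0≢ i)))))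
      (∑-injective (λ i → punchOut (π0≢ i))
        (λ {i} {j} eq → suc-injective (π-inj (punchOut-injective (π0≢ i) (π0≢ j) eq)))
        (f ∘ punchIn (π zero)))))
    (sym (∑-remove (π zero) f))
    where
    π0≢ : ∀ i → π zero ≢ π (suc i)
    π0≢ i eq with π-inj eq
    ... | ()

term≤∑ : (f : Fin n → ℕ) (i : Fin n) → f i ≤ ∑ f
term≤∑ {suc n} f i = ≤-trans (m≤m+n (f i) _) (≤-reflexive (sym (∑-remove i f)))

-- Truth values as numbers and cardinalities of subsets

⟦_⟧ : Bool → ℕ
⟦ true ⟧  = 1
⟦ false ⟧ = 0

⟦⟧≤1 : ∀ b → ⟦ b ⟧ ≤ 1
⟦⟧≤1 true  = ≤-refl
⟦⟧≤1 false = z≤n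

⟦⟧-mono : ∀ {a b} → (a ≡ true → b ≡ true) → ⟦ a ⟧ ≤ ⟦ b ⟧
⟦⟧-mono {false} a⇒b = z≤n
⟦⟧-mono {true}  a⇒b rewrite a⇒b refl = ≤-refl

∧-intro : ∀ {a b} → a ≡ true → b ≡ true → a ∧ b ≡ true
∧-intro refl refl = refl

∧-elim : ∀ {a b} → a ∧ b ≡ true → a ≡ true × b ≡ true
∧-elim {true} {true} refl = refl , refl

not-intro : ∀ {a} → a ≡ false → not a ≡ true
not-intro refl = refl

not-elim : ∀ {a} → not a ≡ true → a ≡ false
not-elim {false} refl = refl

true≢false : ∀ {a} → a ≡ true → a ≡ false → ∀ {ℓ} {A : Set ℓ} → A
true≢false refl ()

¬true : ∀ {a} → ¬ (a ≡ true) → a ≡ false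
¬true {false} _ = refl
¬true {true}  h = ⊥-elim (h refl)

count : (Fin n → Bool) → ℕ
count p = ∑ (⟦_⟧ ∘ p)

count-cong : {p q : Fin n → Bool} → p ≗ q → count p ≡ count q
count-cong p≗q = ∑-cong (cong ⟦_⟧ ∘ p≗q)

count-mono : {p q : Fin n → Bool} → (∀ v → p v ≡ true → q v ≡ true) → count p ≤ count q
count-mono p⊆q = ∑-mono (⟦⟧-mono ∘ p⊆q)

count≤n : (p : Fin n → Bool) → count p ≤ n
count≤n {n} p = ≤-trans (∑-mono (⟦⟧≤1 ∘ p)) (≤-reflexive (∑-one n))

count-split : (p q : Fin n → Bool) →
  count (λ v → p v ∧ q v) + count (λ v → p v ∧ not (q v)) ≡ count p
count-split p q = trans (sym (∑-+ _ _)) (∑-cong (λ v → pt (p v) (q v)))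
  where
  pt : ∀ a b → ⟦ a ∧ b ⟧ + ⟦ a ∧ not b ⟧ ≡ ⟦ a ⟧
  pt false b     = refl
  pt true  false = refl
  pt true  true  = refl

count-not : (p : Fin n → Bool) → count p + count (not ∘ p) ≡ n
count-not {n} p = trans (count-split (λ _ → true) p) (∑-one n)

count-nonempty : (p : Fin n → Bool) → 0 < count p → ∃ λ v → p v ≡ true
count-nonempty {n} p 0<c with any? (λ v → p v ≟ᵇ true)
... | yes found = found
... | no  none  = contradiction (≤-trans 0<c (≤-reflexive
        (trans (∑-cong (λ v → cong ⟦_⟧ (¬true (λ pv → none (v , pv))))) (∑-zero n)))) λ ()

opaque
  singleton : Fin n → Fin n → Bool
  singleton u v = does (u ≟ v)

  singleton-refl : (u : Fin n) → singleton u u ≡ true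
  singleton-refl u = dec-true (u ≟ u) refl

  singleton-≡ : (u v : Fin n) → singleton u v ≡ true → u ≡ v
  singleton-≡ u v eq with u ≟ v
  ... | yes u≡v = u≡v

  singleton-≢ : (u v : Fin n) → u ≢ v → singleton u v ≡ false
  singleton-≢ u v u≢v = dec-false (u ≟ v) u≢v

count-singleton : (u : Fin n) → count (singleton u) ≡ 1
count-singleton {suc n} u = trans (∑-remove u (⟦_⟧ ∘ singleton u))
  (cong₂ _+_ (cong ⟦_⟧ (singleton-refl u))
    (trans (∑-cong (λ j → cong ⟦_⟧ (singleton-≢ u (punchIn u j) (λ eq → punchInᵢ≢i u j (sym eq)))))
      (∑-zero n)))

-- Optimisation over subsets

-- Subsets are compared pointwise, so `Φ` has to respect `≗`. The maximum is the better of the two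
-- maxima over the subsets with and without `zero`.
argmax : (Φ : (Fin n → Bool) → ℕ) → (∀ {p q} → p ≗ q → Φ p ≡ Φ q) →
  ∃ λ p → ∀ q → Φ q ≤ Φ p
argmax {zero}  Φ Φ-cong = (λ ()) , λ q → ≤-reflexive (Φ-cong (λ ()))
argmax {suc n} Φ Φ-cong = pick (best true) (best false)
  where
  ∷-cong : ∀ {b} {p q : Fin n → Bool} → p ≗ q → (b ∷ p) ≗ (b ∷ q)
  ∷-cong eq zero    = refl
  ∷-cong eq (suc i) = eq i
  best : ∀ b → ∃ λ p → ∀ q → Φ (b ∷ q) ≤ Φ (b ∷ p)
  best b = argmax (Φ ∘ (b ∷_)) (Φ-cong ∘ ∷-cong)
  eta : ∀ {b} (q : Fin (suc n) → Bool) → q zero ≡ b → Φ q ≡ Φ (b ∷ (q ∘ suc))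
  eta q refl = Φ-cong λ { zero → refl ; (suc i) → refl }
  pick : (∃ λ p → ∀ q → Φ (true ∷ q) ≤ Φ (true ∷ p)) →
         (∃ λ p → ∀ q → Φ (false ∷ q) ≤ Φ (false ∷ p)) → ∃ λ p → ∀ q → Φ q ≤ Φ p
  pick (p , p-max) (p′ , p′-max) with ≤-total (Φ (true ∷ p)) (Φ (false ∷ p′))
  ... | inj₁ le = (false ∷ p′) , bound
    where
    bound : ∀ q → Φ q ≤ Φ (false ∷ p′)
    bound q with q zero in eq
    ... | true  = ≤-trans (≤-reflexive (eta q eq)) (≤-trans (p-max _) le)
    ... | false = ≤-trans (≤-reflexive (eta q eq)) (p′-max _)
  ... | inj₂ le = (true ∷ p) , bound
    where
    bound : ∀ q → Φ q ≤ Φ (true ∷ p)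
    bound q with q zero in eq
    ... | true  = ≤-trans (≤-reflexive (eta q eq)) (p-max _)
    ... | false = ≤-trans (≤-reflexive (eta q eq)) (≤-trans (p′-max _) le)

-- Maximising the indicator of `D` decides whether any subset satisfies it.
search : (D : (Fin n → Bool) → Bool) → (∀ {p q} → p ≗ q → D p ≡ D q) →
  (∃ λ p → D p ≡ true) ⊎ (∀ p → D p ≡ false)
search D D-cong with argmax (⟦_⟧ ∘ D) (cong ⟦_⟧ ∘ D-cong)
... | p , p-max with D p in eq
...   | true  = inj₁ (p , eq)
...   | false = inj₂ λ q → ⟦⟧≤0 (p-max q)
  where
  ⟦⟧≤0 : ∀ {b} → ⟦ b ⟧ ≤ 0 → b ≡ false
  ⟦⟧≤0 {false} _ = refl

-- Hall's theorem

opaque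
  N : (Fin m → Fin n → Bool) → (Fin m → Bool) → Fin n → Bool
  N rel S v = does (any? (λ u → (S u ∧ rel u v) ≟ᵇ true))

  N-intro : ∀ (rel : Fin m → Fin n → Bool) (S : Fin m → Bool) {u v} →
    S u ≡ true → rel u v ≡ true → N rel S v ≡ true
  N-intro rel S {u} {v} Su uv = dec-true (any? _) (u , ∧-intro Su uv)

  N-elim : ∀ (rel : Fin m → Fin n → Bool) (S : Fin m → Bool) {v} →
    N rel S v ≡ true → ∃ λ u → S u ≡ true × rel u v ≡ true
  N-elim rel S {v} eq with any? (λ u → (S u ∧ rel u v) ≟ᵇ true)
  ... | yes (u , Su∧uv) = u , ∧-elim Su∧uv

⇔⇒≡ : ∀ {a b} → (a ≡ true → b ≡ true) → (b ≡ true → a ≡ true) → a ≡ b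
⇔⇒≡ {true}  {b}     f g = sym (f refl)
⇔⇒≡ {false} {false} f g = refl
⇔⇒≡ {false} {true}  f g = g refl

N-mono : ∀ (rel : Fin m → Fin n → Bool) {S T : Fin m → Bool} →
  (∀ u → S u ≡ true → T u ≡ true) → ∀ v → N rel S v ≡ true → N rel T v ≡ true
N-mono rel {S} {T} S⊆T v NSv with N-elim rel S NSv
... | u , Su , uv = N-intro rel T (S⊆T u Su) uv

N-cong : ∀ (rel : Fin m → Fin n → Bool) {S T : Fin m → Bool} → S ≗ T → N rel S ≗ N rel T
N-cong rel S≗T v = ⇔⇒≡ (N-mono rel (λ u Su → trans (sym (S≗T u)) Su) v)
                       (N-mono rel (λ u Tu → trans (S≗T u) Tu) v)

HallCondition : (Fin n → Bool) → (Fin n → Fin n → Bool) → Set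
HallCondition L rel = ∀ S → (∀ u → S u ≡ true → L u ≡ true) → count S ≤ count (N rel S)

-- `f` is total but unconstrained outside `L`, so matchings of disjoint parts can be glued by a case
-- distinction.
Matching : (Fin n → Bool) → (Fin n → Fin n → Bool) → Set
Matching {n} L rel = Σ (Fin n → Fin n) λ f →
  (∀ {u} → L u ≡ true → rel u (f u) ≡ true) ×
  (∀ {u v} → L u ≡ true → L v ≡ true → f u ≡ f v → u ≡ v)

does-true : ∀ {P : Set} (P? : Dec P) → does P? ≡ true → P
does-true (yes p) refl = p

-- Halmos and Vaughan: if some proper nonempty S has exactly |S| neighbours,
-- S and its complement are matched separately; otherwise any edge can be removed.
hall : ∀ k (L : Fin n → Bool) rel → count L ≤ k → HallCondition L rel → Matching L rel
hall {n} zero L rel |L|≤0 hc = (λ u → u) , (λ Lu → ⊥-elim (empty Lu)) , λ Lu → ⊥-elim (empty Lu)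
  where
  empty : ∀ {u} → ¬ (L u ≡ true)
  empty {u} Lu with ≤-trans (term≤∑ (⟦_⟧ ∘ L) u) |L|≤0
  ... | le rewrite Lu = contradiction le λ ()
hall {n} (suc k) L rel |L|≤1+k hc = split (search D D-cong)
  where
  _∩L : (Fin n → Bool) → Fin n → Bool
  (S ∩L) u = S u ∧ L u
  test : ℕ → ℕ → Bool
  test a b = does (1 ≤? a) ∧ (does (a <? count L) ∧ does (b ≤? a))
  -- `search` ranges over all subsets, so the test is applied to the part of `S` inside `L`.
  D : (Fin n → Bool) → Bool
  D S = test (count (S ∩L)) (count (N rel (S ∩L)))
  D-cong : ∀ {S T} → S ≗ T → D S ≡ D T
  D-cong S≗T = cong₂ test (count-cong eq) (count-cong (N-cong rel eq))
    where eq = λ u → cong (_∧ L u) (S≗T u)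

  tight : ∀ S → (∀ u → S u ≡ true → L u ≡ true) → 1 ≤ count S → count S < count L →
    count (N rel S) ≤ count S → Matching L rel
  tight S S⊆L 1≤S S<L NS≤S = combine
      (hall k S rel (≤-pred (≤-trans S<L |L|≤1+k)) (λ T T⊆S → hc T (λ u → S⊆L u ∘ T⊆S u)))
      (hall k rest rel′ |rest|≤k hc′)
    where
    rest : Fin n → Bool
    rest u = L u ∧ not (S u)
    rel′ : Fin n → Fin n → Bool
    rel′ u v = rel u v ∧ not (N rel S v)
    |rest|≤k : count rest ≤ k
    |rest|≤k = ≤-pred (begin
      1 + count rest                             ≤⟨ +-monoˡ-≤ _ 1≤S ⟩
      count S + count rest                       ≤⟨ +-monoˡ-≤ _ (count-mono (λ u Su → ∧-intro (S⊆L u Su) Su)) ⟩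
      count (λ u → L u ∧ S u) + count rest       ≡⟨ count-split L S ⟩
      count L                                    ≤⟨ |L|≤1+k ⟩
      suc k                                      ∎)
      where open ≤-Reasoning
    -- Hall's condition is applied to the union of `S` and `T`. At most |S| of its neighbours belong
    -- to `S`; the others are neighbours of `T` under `rel′`.
    hc′ : HallCondition rest rel′
    hc′ T T⊆rest = +-cancelˡ-≤ (count S) _ _ (begin
      count S + count T                          ≡⟨ ∑-+ _ _ ⟨
      ∑ (λ u → ⟦ S u ⟧ + ⟦ T u ⟧)               ≤⟨ ∑-mono (λ u → disj (S u) (T u) (proj₂ ∘ ∧-elim ∘ T⊆rest u)) ⟩
      count (λ u → S u ∨ T u)                    ≤⟨ hc _ (λ u → ∨⊆L (S u) (S⊆L u) (proj₁ ∘ ∧-elim ∘ T⊆rest u)) ⟩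
      count (N rel (λ u → S u ∨ T u))            ≤⟨ ∑-mono cover ⟩
      ∑ (λ v → ⟦ N rel S v ⟧ + ⟦ N rel′ T v ⟧)  ≡⟨ ∑-+ _ _ ⟩
      count (N rel S) + count (N rel′ T)         ≤⟨ +-monoˡ-≤ _ NS≤S ⟩
      count S + count (N rel′ T)                 ∎)
      where
      open ≤-Reasoning
      disj : ∀ a b → (b ≡ true → not a ≡ true) → ⟦ a ⟧ + ⟦ b ⟧ ≤ ⟦ a ∨ b ⟧
      disj false b     h = ≤-refl
      disj true  false h = ≤-refl
      disj true  true  h = contradiction (h refl) λ ()
      ∨⊆L : ∀ a {b l} → (a ≡ true → l ≡ true) → (b ≡ true → l ≡ true) → a ∨ b ≡ true → l ≡ true
      ∨⊆L true  f g _ = f refl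
      ∨⊆L false f g h = g h
      cover : ∀ v → ⟦ N rel (λ u → S u ∨ T u) v ⟧ ≤ ⟦ N rel S v ⟧ + ⟦ N rel′ T v ⟧
      cover v with N rel S v in eq
      ... | true  = ≤-trans (⟦⟧≤1 _) (m≤m+n 1 _)
      ... | false = ⟦⟧-mono λ h → inT (N-elim rel (λ u → S u ∨ T u) h)
        where
        inT : (∃ λ u → S u ∨ T u ≡ true × rel u v ≡ true) → N rel′ T v ≡ true
        inT (u , Uu , uv) with S u in Su
        ... | true  = true≢false (N-intro rel S Su uv) eq
        ... | false = N-intro rel′ T Uu (∧-intro uv (not-intro eq))
    combine : Matching S rel → Matching rest rel′ → Matching L rel
    combine (f , f-rel , f-inj) (g , g-rel , g-inj) = h , h-rel , h-inj
      where
      h : Fin n → Fin n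
      h u = if S u then f u else g u
      h-rel : ∀ {u} → L u ≡ true → rel u (h u) ≡ true
      h-rel {u} Lu with S u in Su
      ... | true  = f-rel Su
      ... | false = proj₁ (∧-elim (g-rel (∧-intro Lu (not-intro Su))))
      clash : ∀ {u v} → S u ≡ true → L v ≡ true → S v ≡ false → f u ≢ g v
      clash {u} {v} Su Lv Sv eq = true≢false (N-intro rel S Su (f-rel Su))
        (trans (cong (N rel S) eq) (not-elim (proj₂ (∧-elim {rel v (g v)} (g-rel (∧-intro Lv (not-intro Sv)))))))
      h-inj : ∀ {u v} → L u ≡ true → L v ≡ true → h u ≡ h v → u ≡ v
      h-inj {u} {v} Lu Lv eq with S u in Su | S v in Sv
      ... | true  | true  = f-inj Su Sv eq
      ... | true  | false = ⊥-elim (clash Su Lv Sv eq)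
      ... | false | true  = ⊥-elim (clash Sv Lu Su (sym eq))
      ... | false | false = g-inj (∧-intro Lu (not-intro Su)) (∧-intro Lv (not-intro Sv)) eq

  loose : (∀ S → (∀ u → S u ≡ true → L u ≡ true) → 1 ≤ count S → count S < count L →
    count S < count (N rel S)) → Matching L rel
  loose surplus with any? (λ u → L u ≟ᵇ true)
  ... | no none = hall k L rel
        (≤-trans (≤-reflexive (trans (∑-cong (λ v → cong ⟦_⟧ (¬true (λ Lv → none (v , Lv))))) (∑-zero n))) z≤n) hc
  ... | yes (u₀ , Lu₀) = extend (count-nonempty (N rel (singleton u₀))
          (≤-trans (≤-reflexive (sym (count-singleton u₀)))
            (hc (singleton u₀) (λ u u₀≡u → subst (λ w → L w ≡ true) (singleton-≡ u₀ u u₀≡u) Lu₀))))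
    where
    rest : Fin n → Bool
    rest u = L u ∧ not (singleton u₀ u)
    rest<L : suc (count rest) ≤ count L
    rest<L = begin
      1 + count rest                                    ≡⟨ cong (_+ count rest) (count-singleton u₀) ⟨
      count (singleton u₀) + count rest                 ≤⟨ +-monoˡ-≤ _ (count-mono (λ u u₀≡u →
                                                             ∧-intro (subst (λ w → L w ≡ true) (singleton-≡ u₀ u u₀≡u) Lu₀) u₀≡u)) ⟩
      count (λ u → L u ∧ singleton u₀ u) + count rest   ≡⟨ count-split L (singleton u₀) ⟩
      count L                                           ∎
      where open ≤-Reasoning
    extend : (∃ λ v → N rel (singleton u₀) v ≡ true) → Matching L rel
    extend (v₀ , v₀∈N) = insert (hall k rest rel′ (≤-pred (≤-trans rest<L |L|≤1+k)) hc′)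
      where
      u₀v₀ : rel u₀ v₀ ≡ true
      u₀v₀ with N-elim rel (singleton u₀) v₀∈N
      ... | u , u₀≡u , uv = subst (λ w → rel w v₀ ≡ true) (sym (singleton-≡ u₀ u u₀≡u)) uv
      rel′ : Fin n → Fin n → Bool
      rel′ u v = rel u v ∧ not (singleton v₀ v)
      -- Giving up `v₀` costs `T` at most one neighbour. A nonempty `T` has one to spare, being a
      -- proper subset of `L` that misses `u₀`.
      hc′ : HallCondition rest rel′
      hc′ T T⊆rest with 1 ≤? count T
      ... | no  T≡∅ = ≤-trans (≤-pred (≰⇒> T≡∅)) z≤n
      ... | yes 1≤T = ≤-pred (begin
        suc (count T)                                  ≤⟨ surplus T (λ u → proj₁ ∘ ∧-elim ∘ T⊆rest u) 1≤T
                                                             (≤-trans (s≤s (count-mono T⊆rest)) rest<L) ⟩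
        count (N rel T)                                ≤⟨ ∑-mono cover ⟩
        ∑ (λ v → ⟦ singleton v₀ v ⟧ + ⟦ N rel′ T v ⟧)  ≡⟨ ∑-+ _ _ ⟩
        count (singleton v₀) + count (N rel′ T)        ≡⟨ cong (_+ count (N rel′ T)) (count-singleton v₀) ⟩
        suc (count (N rel′ T))                         ∎)
        where
        open ≤-Reasoning
        cover : ∀ v → ⟦ N rel T v ⟧ ≤ ⟦ singleton v₀ v ⟧ + ⟦ N rel′ T v ⟧
        cover v with singleton v₀ v in eq
        ... | true  = ≤-trans (⟦⟧≤1 _) (m≤m+n 1 _)
        ... | false = ⟦⟧-mono λ h → inT (N-elim rel T h)
          where
          inT : (∃ λ u → T u ≡ true × rel u v ≡ true) → N rel′ T v ≡ true
          inT (u , Tu , uv) = N-intro rel′ T Tu (∧-intro uv (not-intro eq))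
      insert : Matching rest rel′ → Matching L rel
      insert (g , g-rel , g-inj) = h , h-rel , h-inj
        where
        h : Fin n → Fin n
        h u = if singleton u₀ u then v₀ else g u
        h-rel : ∀ {u} → L u ≡ true → rel u (h u) ≡ true
        h-rel {u} Lu with singleton u₀ u in eq
        ... | true  = subst (λ w → rel w v₀ ≡ true) (singleton-≡ u₀ u eq) u₀v₀
        ... | false = proj₁ (∧-elim (g-rel (∧-intro Lu (not-intro eq))))
        clash : ∀ {v} → L v ≡ true → singleton u₀ v ≡ false → v₀ ≢ g v
        clash {v} Lv u₀≢v eq = true≢false (trans (cong (singleton v₀) (sym eq)) (singleton-refl v₀))
          (not-elim (proj₂ (∧-elim {rel v (g v)} (g-rel (∧-intro Lv (not-intro u₀≢v))))))
        h-inj : ∀ {u v} → L u ≡ true → L v ≡ true → h u ≡ h v → u ≡ v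
        h-inj {u} {v} Lu Lv eq with singleton u₀ u in Su | singleton u₀ v in Sv
        ... | true  | true  = trans (sym (singleton-≡ u₀ u Su)) (singleton-≡ u₀ v Sv)
        ... | true  | false = ⊥-elim (clash Lv Sv eq)
        ... | false | true  = ⊥-elim (clash Lu Su (sym eq))
        ... | false | false = g-inj (∧-intro Lu (not-intro Su)) (∧-intro Lv (not-intro Sv)) eq

  split : (∃ λ S → D S ≡ true) ⊎ (∀ S → D S ≡ false) → Matching L rel
  split (inj₁ (S , DS)) with ∧-elim {does (1 ≤? count (S ∩L))} DS
  ... | 1≤S , rest with ∧-elim {does (count (S ∩L) <? count L)} rest
  ...   | S<L , NS≤S = tight (S ∩L) (λ u → proj₂ ∘ ∧-elim {S u})
          (does-true (_ ≤? _) 1≤S) (does-true (_ <? _) S<L) (does-true (_ ≤? _) NS≤S)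
  split (inj₂ none) = loose λ S S⊆L 1≤S S<L → ≰⇒> λ NS≤S →
    let S∩L≗S : (S ∩L) ≗ S
        S∩L≗S u = ⇔⇒≡ (proj₁ ∘ ∧-elim {S u}) (λ Su → ∧-intro Su (S⊆L u Su))
    in true≢false
      (trans (cong₂ test (count-cong S∩L≗S) (count-cong (N-cong rel S∩L≗S)))
        (∧-intro (dec-true (_ ≤? _) 1≤S) (∧-intro (dec-true (_ <? _) S<L) (dec-true (_ ≤? _) NS≤S))))
      (none S)

-- Extremal Hall violators

-- The set in `surplus` consists of `v` and the vertices of `P` that share a neighbour with `v`; in
-- a colouring all of them are white to `v`. The last three fields make `π` respect the division
-- into `P`, its neighbourhood and the rest closely enough to determine how many fixed points there
-- are.
record Barrier {n} (adj : Fin n → Fin n → Bool) : Set where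
  field
    P           : Fin n → Bool
    independent : ∀ {u v} → P u ≡ true → P v ≡ true → adj u v ≡ false
    surplus     : ∀ {v} → P v ≡ true →
      count (adj v) < count (λ w → singleton v w ∨ (P w ∧ N adj (adj v) w))
    π           : Fin n → Fin n
    π-injective : ∀ {u v} → π u ≡ π v → u ≡ v
    π-P         : ∀ {v} → P v ≡ true → v ≡ π v ⊎ adj v (π v) ≡ true
    π-NP        : ∀ {v} → N adj P v ≡ true → adj v (π v) ≡ true × P (π v) ≡ true
    π-rest      : ∀ {v} → P v ≡ false → N adj P v ≡ false → adj v (π v) ≡ true × P (π v) ≡ false

-- A pair is encoded by one number in base `suc n`; the bound `d ≤ n` prevents the second entry from
-- making up for a smaller first one.
lexicographic : ∀ n {a b c d} → suc n * a + c ≤ suc n * b + d → d ≤ n → a ≤ b × (a ≡ b → c ≤ d)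
lexicographic n {a} {b} {c} {d} le d≤n = ≮⇒≥ b≮a , λ { refl → +-cancelˡ-≤ (suc n * a) _ _ le }
  where
  b≮a : ¬ (b < a)
  b≮a b<a = <-irrefl refl (begin-strict
    suc n * b + d          ≤⟨ +-monoʳ-≤ (suc n * b) d≤n ⟩
    suc n * b + n          <⟨ +-monoʳ-< (suc n * b) (n<1+n n) ⟩
    suc n * b + suc n      ≡⟨ +-comm (suc n * b) (suc n) ⟩
    suc n + suc n * b      ≡⟨ *-suc (suc n) b ⟨
    suc n * suc b          ≤⟨ *-monoʳ-≤ (suc n) b<a ⟩
    suc n * a              ≤⟨ m≤m+n _ c ⟩
    suc n * a + c          ≤⟨ le ⟩
    suc n * b + d          ∎)
    where open ≤-Reasoning

-- P maximises |P| - |N(P)| and, subject to that, has the fewest elements.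
optimal : (adj : Fin n → Fin n → Bool) → ∃ λ P → ∀ Q →
  (count Q + count (N adj P) ≤ count P + count (N adj Q)) ×
  (count Q < count P → count Q + count (N adj P) < count P + count (N adj Q))
optimal {n} adj = from (argmax Φ Φ-cong)
  where
  -- Complements replace subtraction: the bracket is |Q| - |N(Q)| shifted by `n`, and the last
  -- summand breaks ties in favour of fewer elements.
  Φ : (Fin n → Bool) → ℕ
  Φ Q = suc n * (count Q + count (not ∘ N adj Q)) + count (not ∘ Q)
  Φ-cong : ∀ {Q R} → Q ≗ R → Φ Q ≡ Φ R
  Φ-cong Q≗R = cong₂ (λ a b → suc n * a + b)
    (cong₂ _+_ (count-cong Q≗R) (count-cong (cong not ∘ N-cong adj Q≗R)))
    (count-cong (cong not ∘ Q≗R))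
  rearrange : ∀ q nq c np → (q + c) + (nq + np) ≡ (q + np) + (nq + c)
  rearrange = solve-∀
  from : (∃ λ P → ∀ Q → Φ Q ≤ Φ P) → _
  from (P , P-max) = P , λ Q → P-weak Q , P-strict Q
    where
    lex : ∀ Q → _
    lex Q = lexicographic n {count Q + count (not ∘ N adj Q)} {count P + count (not ∘ N adj P)}
      {count (not ∘ Q)} (P-max Q) (count≤n _)
    left : ∀ Q → (count Q + count (not ∘ N adj Q)) + (count (N adj Q) + count (N adj P))
               ≡ (count Q + count (N adj P)) + n
    left Q = trans (rearrange (count Q) (count (N adj Q)) _ _)
      (cong ((count Q + count (N adj P)) +_) (count-not (N adj Q)))
    right : ∀ Q → (count P + count (not ∘ N adj P)) + (count (N adj Q) + count (N adj P))
                ≡ (count P + count (N adj Q)) + n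
    right Q = trans (cong ((count P + count (not ∘ N adj P)) +_) (+-comm (count (N adj Q)) _))
      (trans (rearrange (count P) (count (N adj P)) _ _)
        (cong ((count P + count (N adj Q)) +_) (count-not (N adj P))))
    P-weak : ∀ Q → count Q + count (N adj P) ≤ count P + count (N adj Q)
    P-weak Q = +-cancelʳ-≤ n _ _ (begin
      (count Q + count (N adj P)) + n   ≡⟨ left Q ⟨
      (count Q + count (not ∘ N adj Q)) + (count (N adj Q) + count (N adj P)) ≤⟨ +-monoˡ-≤ _ (proj₁ (lex Q)) ⟩
      (count P + count (not ∘ N adj P)) + (count (N adj Q) + count (N adj P)) ≡⟨ right Q ⟩
      (count P + count (N adj Q)) + n   ∎)
      where open ≤-Reasoning
    P-strict : ∀ Q → count Q < count P → count Q + count (N adj P) < count P + count (N adj Q)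
    P-strict Q Q<P = ≤∧≢⇒< (P-weak Q) λ eq → <-irrefl refl (begin-strict
      n                          ≡⟨ count-not Q ⟨
      count Q + count (not ∘ Q)  <⟨ +-mono-<-≤ Q<P (proj₂ (lex Q) (+-cancelʳ-≡ (count (N adj Q) + count (N adj P)) _ _
                                      (trans (left Q) (trans (cong (_+ n) eq) (sym (right Q)))))) ⟩
      count P + count (not ∘ P)  ≡⟨ count-not P ⟩
      n                          ∎)
      where open ≤-Reasoning

module Extremal (adj : Fin n → Fin n → Bool) (adj-sym : ∀ u v → adj u v ≡ adj v u) (P : Fin n → Bool)
  (P-weak : ∀ Q → count Q + count (N adj P) ≤ count P + count (N adj Q))
  (P-strict : ∀ Q → count Q < count P → count Q + count (N adj P) < count P + count (N adj Q))
  where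

  private
    H : Fin n → Bool
    H = N adj P

  flip-adj : ∀ {u v} → adj u v ≡ true → adj v u ≡ true
  flip-adj {u} {v} = trans (adj-sym v u)

  -- Drop from `P` its vertices in `H`. Those that remain have no neighbour in `P`, so their
  -- neighbourhood misses everything that was dropped: it shrinks by at least as much as `P` does,
  -- and `Q` would be a smaller set that is no worse.
  P∩H≡∅ : ∀ {v} → P v ≡ true → H v ≡ false
  P∩H≡∅ {v} Pv with H v in Hv
  ... | false = refl
  ... | true  = ⊥-elim (<-irrefl refl (begin-strict
    count P + count H                                ≡⟨ cong (_+ count H) (count-split P H) ⟨
    (count P∧H + count Q) + count H                  ≡⟨ +-assoc (count P∧H) _ _ ⟩
    count P∧H + (count Q + count H)                  <⟨ +-monoʳ-< (count P∧H) (P-strict Q Q<P) ⟩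
    count P∧H + (count P + count (N adj Q))          ≡⟨ shuffle (count P∧H) (count P) _ ⟩
    count P + (count P∧H + count (N adj Q))          ≤⟨ +-monoʳ-≤ (count P) NQ-small ⟩
    count P + count H                                ∎))
    where
    open ≤-Reasoning
    P∧H Q : Fin n → Bool
    P∧H u = P u ∧ H u
    Q u = P u ∧ not (H u)
    shuffle : ∀ a b c → a + (b + c) ≡ b + (a + c)
    shuffle = solve-∀
    Q<P : count Q < count P
    Q<P = begin
      1 + count Q                ≤⟨ +-monoˡ-≤ (count Q) (≤-trans (≤-reflexive (cong ⟦_⟧ (sym (∧-intro Pv Hv)))) (term≤∑ (⟦_⟧ ∘ P∧H) v)) ⟩
      count P∧H + count Q        ≡⟨ count-split P H ⟩
      count P                    ∎
    NQ-small : count P∧H + count (N adj Q) ≤ count H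
    NQ-small = begin
      count P∧H + count (N adj Q)                  ≡⟨ ∑-+ _ _ ⟨
      ∑ (λ w → ⟦ P∧H w ⟧ + ⟦ N adj Q w ⟧)          ≤⟨ ∑-mono pt ⟩
      count H                                      ∎
      where
      pt : ∀ w → ⟦ P w ∧ H w ⟧ + ⟦ N adj Q w ⟧ ≤ ⟦ H w ⟧
      pt w with N adj Q w in NQw
      ... | false = ≤-trans (≤-reflexive (+-identityʳ _)) (⟦⟧-mono {P w ∧ H w} (proj₂ ∘ ∧-elim {P w}))
      ... | true with N-elim adj Q NQw
      ...   | u , Qu , uw with ∧-elim {P u} Qu
      ...     | Pu , ¬Hu with P w in Pw
      ...       | false = ⟦⟧-mono {true} (λ _ → N-intro adj P Pu uw)
      ...       | true  = true≢false (N-intro adj P Pw (flip-adj uw)) (not-elim ¬Hu)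

  H⇒¬P : ∀ {v} → H v ≡ true → P v ≡ false
  H⇒¬P {v} Hv = ¬true λ Pv → true≢false Hv (P∩H≡∅ Pv)

  independent : ∀ {u v} → P u ≡ true → P v ≡ true → adj u v ≡ false
  independent Pu Pv = ¬true λ uv → true≢false (N-intro adj P Pu uv) (P∩H≡∅ Pv)

  -- Drop from `P` all vertices that share a neighbour with `v`. The rest do not touch the
  -- neighbourhood of `v`, which is therefore lost from `H`; by minimality of `P` more vertices were
  -- dropped than neighbours lost. If `v` has no neighbour, nothing is dropped, and `singleton v`
  -- supplies the required element.
  surplus : ∀ {v} → P v ≡ true →
    count (adj v) < count (λ w → singleton v w ∨ (P w ∧ N adj (adj v) w))
  surplus {v} Pv with 1 ≤? count (adj v)
  ... | no  none = ≤-trans (≰⇒> none) (≤-trans (≤-reflexive (sym (count-singleton v)))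
                     (count-mono {p = singleton v} (λ w eq → cong (_∨ (P w ∧ N adj (adj v) w)) eq)))
  ... | yes 1≤d = ≤-trans (+-cancelʳ-< (count Q + count H) (count (adj v)) (count A) (begin-strict
      count (adj v) + (count Q + count H)               <⟨ +-monoʳ-< (count (adj v)) (P-strict Q Q<P) ⟩
      count (adj v) + (count P + count (N adj Q))       ≡⟨ shuffle (count (adj v)) (count P) _ ⟩
      count P + (count (adj v) + count (N adj Q))       ≤⟨ +-monoʳ-≤ (count P) NQ-small ⟩
      count P + count H                                 ≡⟨ cong (_+ count H) (count-split P A′) ⟨
      (count A + count Q) + count H                     ≡⟨ +-assoc (count A) _ _ ⟩
      count A + (count Q + count H)                     ∎))
      (count-mono {p = A} (λ w Aw → ∨-right (singleton v w) Aw))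
    where
    open ≤-Reasoning
    A A′ Q : Fin n → Bool
    A′ = N adj (adj v)
    A w = P w ∧ A′ w
    Q w = P w ∧ not (A′ w)
    shuffle : ∀ a b c → a + (b + c) ≡ b + (a + c)
    shuffle = solve-∀
    ∨-right : ∀ a {b} → b ≡ true → a ∨ b ≡ true
    ∨-right false h = h
    ∨-right true  h = refl
    Av : A v ≡ true
    Av with count-nonempty (adj v) 1≤d
    ... | u , vu = ∧-intro Pv (N-intro adj (adj v) vu (flip-adj vu))
    Q<P : count Q < count P
    Q<P = begin
      1 + count Q                ≤⟨ +-monoˡ-≤ (count Q) (≤-trans (≤-reflexive (cong ⟦_⟧ (sym Av))) (term≤∑ (⟦_⟧ ∘ A) v)) ⟩
      count A + count Q          ≡⟨ count-split P A′ ⟩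
      count P                    ∎
    NQ-small : count (adj v) + count (N adj Q) ≤ count H
    NQ-small = begin
      count (adj v) + count (N adj Q)                  ≡⟨ ∑-+ _ _ ⟨
      ∑ (λ w → ⟦ adj v w ⟧ + ⟦ N adj Q w ⟧)          ≤⟨ ∑-mono pt ⟩
      count H                                      ∎
      where
      pt : ∀ w → ⟦ adj v w ⟧ + ⟦ N adj Q w ⟧ ≤ ⟦ H w ⟧
      pt w with N adj Q w in NQw
      ... | false = ≤-trans (≤-reflexive (+-identityʳ _)) (⟦⟧-mono {adj v w} (N-intro adj P Pv))
      ... | true with N-elim adj Q NQw
      ...   | u , Qu , uw with ∧-elim {P u} Qu
      ...     | Pu , ¬Au with adj v w in vw
      ...       | false = ⟦⟧-mono {true} (λ _ → N-intro adj P Pu uw)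
      ...       | true  = true≢false (N-intro adj (adj v) vw (flip-adj uw)) (not-elim ¬Au)

  -- A fixed point is allowed only in P; this turns the matching into a permutation.
  rel : Fin n → Fin n → Bool
  rel u v = if P u then singleton u v ∨ adj u v
            else if H u then adj u v ∧ P v
            else adj u v ∧ (not (P v) ∧ not (H v))

  rel-P-self : ∀ {u} → P u ≡ true → rel u u ≡ true
  rel-P-self {u} Pu rewrite Pu | singleton-refl u = refl
  rel-P : ∀ {u v} → P u ≡ true → adj u v ≡ true → rel u v ≡ true
  rel-P {u} {v} Pu uv rewrite Pu | uv with singleton u v
  ... | true  = refl
  ... | false = refl
  rel-H : ∀ {u v} → H u ≡ true → adj u v ≡ true → P v ≡ true → rel u v ≡ true
  rel-H {u} {v} Hu uv Pv rewrite H⇒¬P Hu | Hu | uv | Pv = refl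
  rel-rest : ∀ {u v} → P u ≡ false → H u ≡ false → adj u v ≡ true → P v ≡ false → H v ≡ false → rel u v ≡ true
  rel-rest {u} {v} Pu Hu uv Pv Hv rewrite Pu | Hu | uv | Pv | Hv = refl

  -- Four disjoint sets of images are enough: `SP`, reached by staying put; the further points `A`
  -- of `P`, reached from `SH`; the neighbours of `SP`, which lie in `H`; and the points `X` outside
  -- `P` and `H`. Both bounds come from testing the maximality of `P` against a competitor.
  hc : HallCondition (λ _ → true) rel
  hc S _ = begin
    count S                                                    ≤⟨ ∑-mono parts ⟩
    ∑ (λ v → (⟦ SP v ⟧ + ⟦ SH v ⟧) + ⟦ SR v ⟧)                ≡⟨ trans (∑-+ _ _) (cong (_+ count SR) (∑-+ _ _)) ⟩
    (count SP + count SH) + count SR                           ≤⟨ +-mono-≤ (+-monoʳ-≤ (count SP) boundH) boundR ⟩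
    (count SP + (count A + count (N adj SP))) + count X        ≡⟨ trans (∑-+ _ _) (cong (_+ count X) (trans (∑-+ _ _) (cong (count SP +_) (∑-+ _ _)))) ⟨
    ∑ (λ v → (⟦ SP v ⟧ + (⟦ A v ⟧ + ⟦ N adj SP v ⟧)) + ⟦ X v ⟧)  ≤⟨ ∑-mono images ⟩
    count (N rel S)                                            ∎
    where
    open ≤-Reasoning
    SP SH SR A B X Q₁ Q₂ : Fin n → Bool
    SP v = P v ∧ S v
    SH v = H v ∧ S v
    SR v = S v ∧ (not (P v) ∧ not (H v))
    B v = N adj SH v ∧ not (S v)
    A v = P v ∧ B v
    X v = N adj SR v ∧ (not (P v) ∧ not (H v))
    Q₁ v = P v ∨ SR v
    Q₂ v = P v ∧ not (B v)

    parts : ∀ v → ⟦ S v ⟧ ≤ (⟦ P v ∧ S v ⟧ + ⟦ H v ∧ S v ⟧) + ⟦ S v ∧ (not (P v) ∧ not (H v)) ⟧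
    parts v with S v | P v | H v
    ... | false | _     | _     = z≤n
    ... | true  | true  | _     = s≤s z≤n
    ... | true  | false | true  = s≤s z≤n
    ... | true  | false | false = s≤s z≤n

    -- The competitor adds `SR` to `P`. A vertex of `SR` is outside `H`, hence has no neighbour in
    -- `P`, so all new neighbours lie in `X`.
    boundR : count SR ≤ count X
    boundR = +-cancelˡ-≤ (count P + count H) _ _ (begin
      (count P + count H) + count SR       ≡⟨ shuffle (count P) (count H) (count SR) ⟩
      (count P + count SR) + count H       ≡⟨ cong (_+ count H) (∑-+ _ _) ⟨
      ∑ (λ v → ⟦ P v ⟧ + ⟦ SR v ⟧) + count H  ≤⟨ +-monoˡ-≤ (count H) (∑-mono disj) ⟩
      count Q₁ + count H                   ≤⟨ P-weak Q₁ ⟩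
      count P + count (N adj Q₁)           ≤⟨ +-monoʳ-≤ (count P) (∑-mono cover) ⟩
      count P + ∑ (λ v → ⟦ H v ⟧ + ⟦ X v ⟧)  ≡⟨ cong (count P +_) (∑-+ _ _) ⟩
      count P + (count H + count X)        ≡⟨ +-assoc (count P) _ _ ⟨
      (count P + count H) + count X        ∎)
      where
      shuffle : ∀ a b c → (a + b) + c ≡ (a + c) + b
      shuffle = solve-∀
      disj : ∀ v → ⟦ P v ⟧ + ⟦ S v ∧ (not (P v) ∧ not (H v)) ⟧ ≤ ⟦ P v ∨ (S v ∧ (not (P v) ∧ not (H v))) ⟧
      disj v with P v | S v
      ... | true  | true  = ≤-refl
      ... | true  | false = ≤-refl
      ... | false | _     = ≤-refl
      cover : ∀ v → ⟦ N adj Q₁ v ⟧ ≤ ⟦ H v ⟧ + ⟦ N adj SR v ∧ (not (P v) ∧ not (H v)) ⟧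
      cover v with H v in Hv
      ... | true  = ≤-trans (⟦⟧≤1 _) (m≤m+n 1 _)
      ... | false = ⟦⟧-mono {N adj Q₁ v} λ h → inX (N-elim adj Q₁ h)
        where
        inX : (∃ λ u → Q₁ u ≡ true × adj u v ≡ true) → N adj SR v ∧ (not (P v) ∧ true) ≡ true
        inX (u , Q₁u , uv) with P u in Pu
        ... | true  = true≢false (N-intro adj P Pu uv) Hv
        ... | false with ∧-elim {S u} Q₁u
        ...   | Su , ¬Hu = ∧-intro (N-intro adj SR (∧-intro Su (∧-intro (not-intro Pu) ¬Hu)) uv)
                (∧-intro (not-intro (¬true λ Pv → true≢false (N-intro adj P Pv (flip-adj uv)) (not-elim ¬Hu))) refl)

    -- The competitor removes from `P` the neighbours of `SH` outside `S`. A vertex that stays is in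
    -- `S` or has no neighbour in `SH`, so the new neighbourhood is covered by `H∖S` and the
    -- neighbours of `SP`.
    boundH : count SH ≤ count A + count (N adj SP)
    boundH = +-cancelˡ-≤ (count P + count H∖S) _ _ (begin
      (count P + count H∖S) + count SH     ≡⟨ shuffle₁ (count P) (count H∖S) (count SH) ⟩
      count P + (count SH + count H∖S)     ≡⟨ cong₂ _+_ (sym (count-split P B)) (count-split H S) ⟩
      (count A + count Q₂) + count H       ≡⟨ +-assoc (count A) _ _ ⟩
      count A + (count Q₂ + count H)       ≤⟨ +-monoʳ-≤ (count A) (P-weak Q₂) ⟩
      count A + (count P + count (N adj Q₂))   ≤⟨ +-monoʳ-≤ (count A) (+-monoʳ-≤ (count P) (∑-mono cover)) ⟩
      count A + (count P + ∑ (λ v → ⟦ H∖S v ⟧ + ⟦ N adj SP v ⟧))  ≡⟨ cong (λ z → count A + (count P + z)) (∑-+ _ _) ⟩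
      count A + (count P + (count H∖S + count (N adj SP)))  ≡⟨ shuffle₂ (count A) (count P) _ _ ⟩
      (count P + count H∖S) + (count A + count (N adj SP))  ∎)
      where
      H∖S : Fin n → Bool
      H∖S v = H v ∧ not (S v)
      shuffle₁ : ∀ a b c → (a + b) + c ≡ a + (c + b)
      shuffle₁ = solve-∀
      shuffle₂ : ∀ a b c d → a + (b + (c + d)) ≡ (b + c) + (a + d)
      shuffle₂ = solve-∀
      cover : ∀ v → ⟦ N adj Q₂ v ⟧ ≤ ⟦ H v ∧ not (S v) ⟧ + ⟦ N adj SP v ⟧
      cover v with N adj Q₂ v in eq
      ... | false = z≤n
      ... | true with N-elim adj Q₂ eq
      ...   | u , Q₂u , uv with ∧-elim {P u} Q₂u
      ...     | Pu , ¬Bu with S u in Su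
      ...       | true  = ≤-trans (⟦⟧-mono {true} {N adj SP v} λ _ → N-intro adj SP (∧-intro Pu Su) uv) (m≤n+m _ _)
      ...       | false = ≤-trans (⟦⟧-mono {true} {H v ∧ not (S v)} λ _ →
                  ∧-intro Hv (not-intro (¬true λ Sv → true≢false
                    (∧-intro (N-intro adj SH (∧-intro Hv Sv) (flip-adj uv)) refl) (not-elim ¬Bu)))) (m≤m+n _ _)
        where
        Hv : H v ≡ true
        Hv = N-intro adj P Pu uv

    images : ∀ v → (⟦ P v ∧ S v ⟧ + (⟦ P v ∧ B v ⟧ + ⟦ N adj SP v ⟧)) + ⟦ N adj SR v ∧ (not (P v) ∧ not (H v)) ⟧
                   ≤ ⟦ N rel S v ⟧
    images v with P v in Pv
    ... | true with N adj SR v ∧ false in eq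
    ...   | true  = contradiction (proj₂ (∧-elim {N adj SR v} eq)) λ ()
    ...   | false with N adj SP v in NSPv
    ...     | true  = true≢false (N-mono adj (λ u → proj₁ ∘ ∧-elim {P u}) v NSPv) (P∩H≡∅ Pv)
    ...     | false with S v in Sv
    ...       | true with N adj SH v
    ...         | true  = ⟦⟧-mono {true} {N rel S v} λ _ → N-intro rel S Sv (rel-P-self Pv)
    ...         | false = ⟦⟧-mono {true} {N rel S v} λ _ → N-intro rel S Sv (rel-P-self Pv)
    images v | true | false | false | false with N adj SH v in NSHv
    ...         | false = z≤n
    ...         | true with N-elim adj SH NSHv
    ...           | u , SHu , uv = ⟦⟧-mono {true} {N rel S v} λ _ →
                      N-intro rel S (proj₂ (∧-elim {H u} SHu)) (rel-H (proj₁ (∧-elim SHu)) uv Pv)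
    images v | false with H v in Hv
    ... | true with N adj SR v ∧ false in eq
    ...   | true  = contradiction (proj₂ (∧-elim {N adj SR v} eq)) λ ()
    ...   | false = ≤-trans (≤-reflexive (+-identityʳ _)) (⟦⟧-mono {N adj SP v} λ h → inN (N-elim adj SP h))
      where
      inN : (∃ λ u → SP u ≡ true × adj u v ≡ true) → N rel S v ≡ true
      inN (u , SPu , uv) = N-intro rel S (proj₂ (∧-elim {P u} SPu)) (rel-P (proj₁ (∧-elim SPu)) uv)
    images v | false | false with N adj SP v in NSPv
    ... | true  = true≢false (N-mono adj (λ u → proj₁ ∘ ∧-elim {P u}) v NSPv) Hv
    ... | false = ⟦⟧-mono {N adj SR v ∧ true} λ h → inN (N-elim adj SR (proj₁ (∧-elim h)))
      where
      inN : (∃ λ u → SR u ≡ true × adj u v ≡ true) → N rel S v ≡ true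
      inN (u , SRu , uv) with ∧-elim {S u} SRu
      ... | Su , ¬P¬H with ∧-elim {not (P u)} ¬P¬H
      ...   | ¬Pu , ¬Hu = N-intro rel S Su (rel-rest (not-elim ¬Pu) (not-elim ¬Hu) uv Pv Hv)

  module _ (π : Fin n → Fin n) (π-rel : ∀ u → rel u (π u) ≡ true) where

    π-P : ∀ {v} → P v ≡ true → v ≡ π v ⊎ adj v (π v) ≡ true
    π-P {v} Pv with π-rel v
    ... | r rewrite Pv with singleton v (π v) in eq
    ...   | true  = inj₁ (singleton-≡ v (π v) eq)
    ...   | false = inj₂ r

    π-NP : ∀ {v} → H v ≡ true → adj v (π v) ≡ true × P (π v) ≡ true
    π-NP {v} Hv with π-rel v
    ... | r rewrite H⇒¬P Hv | Hv = ∧-elim r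

    π-rest : ∀ {v} → P v ≡ false → H v ≡ false → adj v (π v) ≡ true × P (π v) ≡ false
    π-rest {v} Pv Hv with π-rel v
    ... | r rewrite Pv | Hv with ∧-elim {adj v (π v)} r
    ...   | vπ , ¬P¬H = vπ , not-elim (proj₁ (∧-elim {not (P (π v))} ¬P¬H))

barrier : (adj : Fin n → Fin n → Bool) → (∀ u v → adj u v ≡ adj v u) → Barrier adj
barrier {n} adj adj-sym with optimal adj
... | P , P-opt = build (hall n (λ _ → true) X.rel (count≤n _) X.hc)
  where
  module X = Extremal adj adj-sym P (proj₁ ∘ P-opt) (proj₂ ∘ P-opt)
  build : Matching (λ _ → true) X.rel → Barrier adj
  build (π , π-rel , π-inj) = record
    { P           = P
    ; independent = X.independent
    ; surplus     = X.surplus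
    ; π           = π
    ; π-injective = π-inj refl refl
    ; π-P         = X.π-P π (λ u → π-rel refl)
    ; π-NP        = X.π-NP π (λ u → π-rel refl)
    ; π-rest      = X.π-rest π (λ u → π-rel refl)
    }

-- Double sums

∑∑ : (Fin m → Fin n → ℕ) → ℕ
∑∑ f = ∑ λ u → ∑ (f u)

∑∑-cong : {f g : Fin m → Fin n → ℕ} → (∀ u v → f u v ≡ g u v) → ∑∑ f ≡ ∑∑ g
∑∑-cong f≗g = ∑-cong (∑-cong ∘ f≗g)

∑∑-mono : {f g : Fin m → Fin n → ℕ} → (∀ u v → f u v ≤ g u v) → ∑∑ f ≤ ∑∑ g
∑∑-mono f≤g = ∑-mono (∑-mono ∘ f≤g)

∑∑-+ : (f g : Fin m → Fin n → ℕ) → ∑∑ (λ u v → f u v + g u v) ≡ ∑∑ f + ∑∑ g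
∑∑-+ f g = trans (∑-cong (λ u → ∑-+ (f u) (g u))) (∑-+ _ _)

∑∑-*ˡ : ∀ k (f : Fin m → Fin n → ℕ) → ∑∑ (λ u v → k * f u v) ≡ k * ∑∑ f
∑∑-*ˡ k f = trans (∑-cong (λ u → ∑-*ˡ k (f u))) (∑-*ˡ k _)

∑-*ʳ : ∀ k (f : Fin n → ℕ) → ∑ (λ i → f i * k) ≡ ∑ f * k
∑-*ʳ k f = trans (∑-cong (λ i → *-comm (f i) k)) (trans (∑-*ˡ k f) (*-comm k _))

∑∑-* : (f : Fin m → ℕ) (g : Fin n → ℕ) → ∑∑ (λ u v → f u * g v) ≡ ∑ f * ∑ g
∑∑-* f g = trans (∑-cong (λ u → ∑-*ˡ (f u) g)) (∑-*ʳ (∑ g) f)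

∑∑-sym-mono : (f g : Fin n → Fin n → ℕ) →
  (∀ u v → f u v + f v u ≤ g u v + g v u) → ∑∑ f ≤ ∑∑ g
∑∑-sym-mono f g le = *-cancelˡ-≤ 2 (begin
  2 * ∑∑ f                       ≡⟨ double f ⟨
  ∑∑ (λ u v → f u v + f v u)     ≤⟨ ∑∑-mono le ⟩
  ∑∑ (λ u v → g u v + g v u)     ≡⟨ double g ⟩
  2 * ∑∑ g                       ∎)
  where
  open ≤-Reasoning
  double : ∀ (f : Fin _ → Fin _ → ℕ) → ∑∑ (λ u v → f u v + f v u) ≡ 2 * ∑∑ f
  double f = trans (∑∑-+ f (flip f)) (cong (∑∑ f +_) (trans (sym (∑-swap f)) (sym (+-identityʳ _))))

-- Colourings of the pairs of vertices

data OneOf : Bool → Bool → Bool → Set where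
  one₁ : OneOf true false false
  one₂ : OneOf false true false
  one₃ : OneOf false false true

-- W marks the non-edges; loops count as white.
record Colouring (n : ℕ) : Set where
  field
    R B W : Fin n → Fin n → Bool
    oneOf : ∀ u v → OneOf (R u v) (B u v) (W u v)
    R-sym : ∀ u v → R u v ≡ R v u
    B-sym : ∀ u v → B u v ≡ B v u
    W-sym : ∀ u v → W u v ≡ W v u
    loop  : ∀ v → W v v ≡ true
    RBW   : ∀ {a b c} → R a b ≡ true → B b c ≡ true → W a c ≡ true

  BRW : ∀ {a b c} → B a b ≡ true → R b c ≡ true → W a c ≡ true
  BRW {a} {b} {c} ab bc = trans (W-sym a c) (RBW (trans (R-sym c b) bc) (trans (B-sym b a) ab))

  r b w : Fin n → Fin n → ℕ
  r u v = ⟦ R u v ⟧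
  b u v = ⟦ B u v ⟧
  w u v = ⟦ W u v ⟧

  r+w≤1 : ∀ u v → r u v + w u v ≤ 1
  r+w≤1 u v with R u v | B u v | W u v | oneOf u v
  ... | _ | _ | _ | one₁ = ≤-refl
  ... | _ | _ | _ | one₂ = z≤n
  ... | _ | _ | _ | one₃ = ≤-refl

  R⇒¬W : ∀ {u v} → R u v ≡ true → W u v ≡ false
  R⇒¬W {u} {v} uv with R u v | B u v | W u v | oneOf u v
  ... | _ | _ | _ | one₁ = refl

  R⇒¬B : ∀ {u v} → R u v ≡ true → B u v ≡ false
  R⇒¬B {u} {v} uv with R u v | B u v | W u v | oneOf u v
  ... | _ | _ | _ | one₁ = refl

swap : Colouring n → Colouring n
swap G = record
  { R = B ; B = R ; W = W
  ; oneOf = λ u v → one (oneOf u v)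
  ; R-sym = B-sym ; B-sym = R-sym ; W-sym = W-sym ; loop = loop ; RBW = BRW }
  where
  open Colouring G
  one : ∀ {a b c} → OneOf a b c → OneOf b a c
  one one₁ = one₂
  one one₂ = one₁
  one one₃ = one₃

-- fu and fu′ say whether u is a fixed point of π and of σ.
module _ (fu fu′ fv fv′ : Bool) where
  gain cost : Bool → Bool → Bool → ℕ
  gain r b w = ⟦ r ⟧ + (2 * (⟦ not fu ⟧ * (⟦ not fv′ ⟧ * ⟦ w ⟧))
    + (⟦ not fu ∧ not fu′ ⟧ * (⟦ not fv ∧ not fv′ ⟧ * ⟦ b ⟧)
    + (⟦ fu ⟧ * (⟦ fv ⟧ * ⟦ w ⟧) + ⟦ not fu ⟧ * (⟦ fv ⟧ + ⟦ fv′ ⟧))))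
  cost r b w = ⟦ w ⟧ + (⟦ not fu ⟧ * ⟦ not fv′ ⟧
    + 2 * (⟦ fu ⟧ * ⟦ r ⟧ + ⟦ fu′ ⟧ * (⟦ not fv ⟧ * ⟦ r ⟧)))

-- The weights make both sides equal in almost all cases; if neither vertex is fixed by `π` or `σ`,
-- this is the fact that the pair has exactly one colour. There is slack only for a red pair of two
-- fixed points of `π`. A blue pair of two fixed points of `σ` would violate the inequality, hence
-- the last hypothesis.
gain≤cost : ∀ fu fu′ fv fv′ {r b w} → OneOf r b w →
  (fu ≡ true → fu′ ≡ false) → (fv ≡ true → fv′ ≡ false) →
  (fu′ ≡ true → fv′ ≡ true → b ≡ false) →
  gain fu fu′ fv fv′ r b w + gain fv fv′ fu fu′ r b w ≤ cost fu fu′ fv fv′ r b w + cost fv fv′ fu fu′ r b w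
gain≤cost true  true  _     _     _    d _ _ = contradiction (d refl) λ ()
gain≤cost _     _     true  true  _    _ d _ = contradiction (d refl) λ ()
gain≤cost false true  false true  one₂ _ _ e = contradiction (e refl refl) λ ()
gain≤cost false true  false true  one₁ _ _ _ = ≤ᵇ⇒≤ _ _ tt
gain≤cost false true  false true  one₃ _ _ _ = ≤ᵇ⇒≤ _ _ tt
gain≤cost false false false false one₁ _ _ _ = ≤ᵇ⇒≤ _ _ tt
gain≤cost false false false false one₂ _ _ _ = ≤ᵇ⇒≤ _ _ tt
gain≤cost false false false false one₃ _ _ _ = ≤ᵇ⇒≤ _ _ tt
gain≤cost false false false true  one₁ _ _ _ = ≤ᵇ⇒≤ _ _ tt
gain≤cost false false false true  one₂ _ _ _ = ≤ᵇ⇒≤ _ _ tt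
gain≤cost false false false true  one₃ _ _ _ = ≤ᵇ⇒≤ _ _ tt
gain≤cost false false true  false one₁ _ _ _ = ≤ᵇ⇒≤ _ _ tt
gain≤cost false false true  false one₂ _ _ _ = ≤ᵇ⇒≤ _ _ tt
gain≤cost false false true  false one₃ _ _ _ = ≤ᵇ⇒≤ _ _ tt
gain≤cost false true  false false one₁ _ _ _ = ≤ᵇ⇒≤ _ _ tt
gain≤cost false true  false false one₂ _ _ _ = ≤ᵇ⇒≤ _ _ tt
gain≤cost false true  false false one₃ _ _ _ = ≤ᵇ⇒≤ _ _ tt
gain≤cost false true  true  false one₁ _ _ _ = ≤ᵇ⇒≤ _ _ tt
gain≤cost false true  true  false one₂ _ _ _ = ≤ᵇ⇒≤ _ _ tt
gain≤cost false true  true  false one₃ _ _ _ = ≤ᵇ⇒≤ _ _ tt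
gain≤cost true  false false false one₁ _ _ _ = ≤ᵇ⇒≤ _ _ tt
gain≤cost true  false false false one₂ _ _ _ = ≤ᵇ⇒≤ _ _ tt
gain≤cost true  false false false one₃ _ _ _ = ≤ᵇ⇒≤ _ _ tt
gain≤cost true  false false true  one₁ _ _ _ = ≤ᵇ⇒≤ _ _ tt
gain≤cost true  false false true  one₂ _ _ _ = ≤ᵇ⇒≤ _ _ tt
gain≤cost true  false false true  one₃ _ _ _ = ≤ᵇ⇒≤ _ _ tt
gain≤cost true  false true  false one₁ _ _ _ = ≤ᵇ⇒≤ _ _ tt
gain≤cost true  false true  false one₂ _ _ _ = ≤ᵇ⇒≤ _ _ tt
gain≤cost true  false true  false one₃ _ _ _ = ≤ᵇ⇒≤ _ _ tt

-- Fixed points of the permutation of a barrier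

module Fixed {adj : Fin n → Fin n → Bool} (irrefl : ∀ v → adj v v ≡ false) (S : Barrier adj) where
  open Barrier S

  H : Fin n → Bool
  H = N adj P

  fixed : Fin n → Bool
  fixed v = singleton v (π v)

  P⇒¬H : ∀ {v} → P v ≡ true → H v ≡ false
  P⇒¬H {v} Pv = ¬true λ Hv → let u , Pu , uv = N-elim adj P Hv in true≢false uv (independent Pu Pv)

  private
    fixed-irrefl : ∀ {v} → fixed v ≡ true → adj v (π v) ≡ true → ∀ {ℓ} {A : Set ℓ} → A
    fixed-irrefl {v} fv vπ = true≢false vπ (subst (λ z → adj v z ≡ false) (singleton-≡ v (π v) fv) (irrefl v))

  fixed⇒P : ∀ {v} → fixed v ≡ true → P v ≡ true
  fixed⇒P {v} fv with P v in Pv | H v in Hv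
  ... | true  | _     = refl
  ... | false | true  = fixed-irrefl fv (proj₁ (π-NP Hv))
  ... | false | false = fixed-irrefl fv (proj₁ (π-rest Pv Hv))

  moved⇒adj : ∀ {v} → fixed v ≡ false → adj v (π v) ≡ true
  moved⇒adj {v} fv with P v in Pv | H v in Hv
  ... | false | true  = proj₁ (π-NP Hv)
  ... | false | false = proj₁ (π-rest Pv Hv)
  ... | true  | _ with π-P Pv
  ...   | inj₂ vπ = vπ
  ...   | inj₁ eq = true≢false (subst (λ z → singleton v z ≡ true) eq (singleton-refl v)) fv

  fixed-π : ∀ v → fixed (π v) ≡ fixed v
  fixed-π v = ⇔⇒≡
    (λ h → subst (λ z → singleton v z ≡ true) (π-injective (singleton-≡ _ _ h)) (singleton-refl v))
    (λ h → subst (λ z → singleton (π v) z ≡ true) (cong π (singleton-≡ _ _ h)) (singleton-refl (π v)))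

  -- The preimage of `P` under `π` consists of `H` and the fixed points: as `P` is independent, a
  -- vertex of `P` with image in `P` cannot have moved.
  count-P : count P ≡ count H + count fixed
  count-P = trans (sym (∑-injective π π-injective (⟦_⟧ ∘ P))) (trans (∑-cong pt) (∑-+ _ _))
    where
    pt : ∀ v → ⟦ P (π v) ⟧ ≡ ⟦ H v ⟧ + ⟦ fixed v ⟧
    pt v with H v in Hv
    ... | true rewrite proj₂ (π-NP Hv) with fixed v in fv
    ...   | false = refl
    ...   | true  = true≢false Hv (P⇒¬H (fixed⇒P fv))
    pt v | false with P v in Pv
    ...   | false rewrite proj₂ (π-rest Pv Hv) with fixed v in fv
    ...     | false = refl
    ...     | true  = true≢false (fixed⇒P fv) Pv
    pt v | false | true with fixed v in fv
    ...     | true  = cong ⟦_⟧ (subst (λ z → P z ≡ true) (singleton-≡ v (π v) fv) Pv)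
    ...     | false = cong ⟦_⟧ (¬true λ Pπ → true≢false (moved⇒adj fv) (independent Pv Pπ))

-- Red against white when `σ` has no more fixed points than `π`

final-arithmetic : ∀ {h′ t₁ t₂ q δ RF RF′₁ RF′₂ e} → t₂ ≤ q → 1 ≤ t₁ + t₂ →
  RF ≤ ((t₁ + t₂) + δ) * h′ + e →
  2 * RF′₁ + 2 * e + 2 * t₁ ≤ t₁ * ((2 * (t₁ + h′) + q + ((t₁ + t₂) + δ)) + (t₁ + t₂)) →
  RF′₂ + t₂ ≤ t₂ * ((t₁ + h′) + q) →
  2 * (RF + (RF′₁ + RF′₂)) + (((t₁ + t₂) + δ) + (t₁ + t₂)) ≤ (2 * (t₁ + h′) + q) * (((t₁ + t₂) + δ) + (t₁ + t₂))
final-arithmetic {h′} {t₁} {t₂} {q} {δ} {RF} {RF′₁} {RF′₂} {e} t₂≤m 1≤t RF≤ RF′₁≤ RF′₂≤ =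
  -- The three bounds leave the slack `t₁ * q + δ * (q + t₁)` less `δ`. It is nonnegative because
  -- `q + t₁` is at least `t₂ + t₁`, hence positive. The terms `2 * e` cancel.
  +-cancelʳ-≤ (2 * e + 2 * t₁ + 2 * t₂ + (t₁ * q + δ * (q + t₁))) _ _ (begin
    2 * (RF + (RF′₁ + RF′₂)) + (ρ + τ) + (2 * e + 2 * t₁ + 2 * t₂ + (t₁ * q + δ * (q + t₁)))
      ≡⟨ collect RF RF′₁ RF′₂ e t₁ t₂ (ρ + τ) (t₁ * q + δ * (q + t₁)) ⟩
    2 * RF + (2 * RF′₁ + 2 * e + 2 * t₁) + 2 * (RF′₂ + t₂) + ((ρ + τ) + (t₁ * q + δ * (q + t₁)))
      ≤⟨ +-monoˡ-≤ _ (+-mono-≤ (+-mono-≤ (*-monoʳ-≤ 2 RF≤) RF′₁≤) (*-monoʳ-≤ 2 RF′₂≤)) ⟩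
    2 * (ρ * h′ + e) + t₁ * ((2 * (t₁ + h′) + q + ρ) + τ) + 2 * (t₂ * ((t₁ + h′) + q)) + ((ρ + τ) + (t₁ * q + δ * (q + t₁)))
      ≡⟨ identity h′ t₁ t₂ q δ e ⟩
    (2 * (t₁ + h′) + q) * (ρ + τ) + (2 * e + 2 * t₁ + 2 * t₂ + δ * 1)
      ≤⟨ +-monoʳ-≤ ((2 * (t₁ + h′) + q) * (ρ + τ)) (+-monoʳ-≤ (2 * e + 2 * t₁ + 2 * t₂)
           (≤-trans (*-monoʳ-≤ δ 1≤m+t₁) (m≤n+m _ _))) ⟩
    (2 * (t₁ + h′) + q) * (ρ + τ) + (2 * e + 2 * t₁ + 2 * t₂ + (t₁ * q + δ * (q + t₁))) ∎)
  where
  open ≤-Reasoning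
  τ ρ : ℕ
  τ = t₁ + t₂
  ρ = τ + δ
  1≤m+t₁ : 1 ≤ q + t₁
  1≤m+t₁ = ≤-trans 1≤t (≤-trans (+-monoʳ-≤ t₁ t₂≤m) (≤-reflexive (+-comm t₁ q)))
  collect : ∀ RF RF′₁ RF′₂ e t₁ t₂ s u → 2 * (RF + (RF′₁ + RF′₂)) + s + (2 * e + 2 * t₁ + 2 * t₂ + u)
    ≡ 2 * RF + (2 * RF′₁ + 2 * e + 2 * t₁) + 2 * (RF′₂ + t₂) + (s + u)
  collect = solve-∀
  identity : ∀ h′ t₁ t₂ q δ e →
    2 * (((t₁ + t₂) + δ) * h′ + e) + t₁ * ((2 * (t₁ + h′) + q + ((t₁ + t₂) + δ)) + (t₁ + t₂))
      + 2 * (t₂ * ((t₁ + h′) + q)) + ((((t₁ + t₂) + δ) + (t₁ + t₂)) + (t₁ * q + δ * (q + t₁)))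
    ≡ (2 * (t₁ + h′) + q) * (((t₁ + t₂) + δ) + (t₁ + t₂)) + (2 * e + 2 * t₁ + 2 * t₂ + δ * 1)
  identity = solve-∀

module Count (G : Colouring n) (SR : Barrier (Colouring.R G)) (SB : Barrier (Colouring.B G)) where
  open Colouring G
  open Barrier SR using (P; π; π-injective)
  open Barrier SB using () renaming (P to P′; π to σ; π-injective to σ-injective; independent to independent′)

  R-irrefl : ∀ v → R v v ≡ false
  R-irrefl v = ¬true λ vv → true≢false (loop v) (R⇒¬W vv)
  B-irrefl : ∀ v → B v v ≡ false
  B-irrefl v = ¬true λ vv → true≢false (loop v) (Colouring.R⇒¬W (swap G) vv)

  open Fixed R-irrefl SR using (H; fixed⇒P; moved⇒adj; fixed-π; count-P; P⇒¬H) renaming (fixed to f)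
  open Fixed B-irrefl SB using () renaming (fixed to f′; fixed⇒P to fixed⇒P′; moved⇒adj to moved⇒adj′; fixed-π to fixed-σ)

  ρ τ X Y c : ℕ
  ρ = count f
  τ = count f′
  X = count (not ∘ f)
  Y = count (not ∘ f′)
  c = count λ v → not (f v) ∧ not (f′ v)

  R-σ : ∀ {u v} → f′ v ≡ false → R u v ≡ true → W u (σ v) ≡ true
  R-σ f′v uv = RBW uv (moved⇒adj′ f′v)

  -- An everywhere moved σ pairs each red pair uv with the white pair u(σ v).
  no-fixed-σ : τ ≡ 0 → ∑∑ r + n ≤ ∑∑ w
  no-fixed-σ τ≡0 = begin
    ∑∑ r + n                                       ≡⟨ cong (∑∑ r +_) (∑-one n) ⟨
    ∑∑ r + ∑ {n} (λ _ → 1)                         ≡⟨ ∑-+ _ _ ⟨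
    ∑ (λ u → ∑ (r u) + 1)                          ≤⟨ ∑-mono row ⟩
    ∑∑ w                                           ∎
    where
    open ≤-Reasoning
    f′≡false : ∀ v → f′ v ≡ false
    f′≡false v = ¬true λ f′v → contradiction
      (≤-trans (≤-reflexive (cong ⟦_⟧ (sym f′v))) (≤-trans (term≤∑ (⟦_⟧ ∘ f′) v) (≤-reflexive τ≡0))) λ ()
    -- If `u` is `σ v`, the pair `u (σ v)` is a white loop while `u v` is blue. So each row has one
    -- white pair to spare, and together these give the summand `n`.
    pt : ∀ u v → r u v + ⟦ singleton u (σ v) ⟧ ≤ w u (σ v)
    pt u v with singleton u (σ v) in eq
    ... | false = ≤-trans (≤-reflexive (+-identityʳ _)) (⟦⟧-mono {R u v} (R-σ (f′≡false v)))
    ... | true with R u v in uv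
    ...   | false = ⟦⟧-mono {true} λ _ → subst (λ z → W u z ≡ true) (singleton-≡ u (σ v) eq) (loop u)
    ...   | true  = true≢false (subst (λ z → B v z ≡ true) (sym (singleton-≡ u (σ v) eq)) (moved⇒adj′ (f′≡false v)))
                      (trans (B-sym v u) (R⇒¬B uv))
    row : ∀ u → ∑ (r u) + 1 ≤ ∑ (w u)
    row u = begin
      ∑ (r u) + 1                                            ≡⟨ cong (∑ (r u) +_) (trans (sym (count-singleton u))
                                                                  (sym (∑-injective σ σ-injective (⟦_⟧ ∘ singleton u)))) ⟩
      ∑ (r u) + ∑ (λ v → ⟦ singleton u (σ v) ⟧)              ≡⟨ ∑-+ _ _ ⟨
      ∑ (λ v → r u v + ⟦ singleton u (σ v) ⟧)                ≤⟨ ∑-mono (pt u) ⟩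
      ∑ (λ v → w u (σ v))                                    ≡⟨ ∑-injective σ σ-injective (w u) ⟩
      ∑ (w u)                                                ∎

  module _ (f′⇒¬P : ∀ {v} → f′ v ≡ true → P v ≡ false) where

    disjoint-f : ∀ {v} → f v ≡ true → f′ v ≡ false
    disjoint-f fv = ¬true λ f′v → true≢false (fixed⇒P fv) (f′⇒¬P f′v)

    k : Fin n → Fin n → ℕ
    k u v = ⟦ not (f u) ⟧ * (⟦ not (f′ v) ⟧ * w u v)

    K Bc Fw RF RF′ : ℕ
    K  = ∑∑ k
    Bc = ∑∑ λ u v → ⟦ not (f u) ∧ not (f′ u) ⟧ * (⟦ not (f v) ∧ not (f′ v) ⟧ * b u v)
    Fw = ∑∑ λ u v → ⟦ f u ⟧ * (⟦ f v ⟧ * w u v)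
    RF  = ∑∑ λ u v → ⟦ f u ⟧ * r u v
    RF′  = ∑∑ λ u v → ⟦ f′ u ⟧ * (⟦ not (f v) ⟧ * r u v)

    -- This is `gain≤cost` over all ordered pairs. The two orders of a pair are compared together,
    -- since the inequality fails for single orders.
    summed : ∑∑ r + (2 * K + (Bc + (Fw + X * (ρ + τ)))) ≤ ∑∑ w + (X * Y + 2 * (RF + RF′))
    summed = begin
      ∑∑ r + (2 * K + (Bc + (Fw + X * (ρ + τ))))   ≡⟨ trans (∑∑-+ _ _) (cong (∑∑ r +_)
                                                        (trans (∑∑-+ _ _) (cong₂ _+_ (∑∑-*ˡ 2 k)
                                                        (trans (∑∑-+ _ _) (cong (Bc +_)
                                                        (trans (∑∑-+ _ _) (cong (Fw +_)
                                                        (trans (∑∑-* (λ u → ⟦ not (f u) ⟧) (λ v → ⟦ f v ⟧ + ⟦ f′ v ⟧)) (cong (X *_) (∑-+ _ _)))))))))) ⟨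
      ∑∑ G′                                        ≤⟨ ∑∑-sym-mono G′ C′ pt ⟩
      ∑∑ C′                                        ≡⟨ trans (∑∑-+ _ _) (cong (∑∑ w +_)
                                                        (trans (∑∑-+ _ _) (cong₂ _+_ (∑∑-* (λ u → ⟦ not (f u) ⟧) (λ v → ⟦ not (f′ v) ⟧))
                                                        (trans (∑∑-*ˡ 2 _) (cong (2 *_) (∑∑-+ _ _)))))) ⟩
      ∑∑ w + (X * Y + 2 * (RF + RF′))                 ∎
      where
      open ≤-Reasoning
      G′ C′ : Fin n → Fin n → ℕ
      G′ u v = gain (f u) (f′ u) (f v) (f′ v) (R u v) (B u v) (W u v)
      C′ u v = cost (f u) (f′ u) (f v) (f′ v) (R u v) (B u v) (W u v)
      pt : ∀ u v → G′ u v + G′ v u ≤ C′ u v + C′ v u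
      pt u v rewrite R-sym v u | B-sym v u | W-sym v u =
        gain≤cost (f u) (f′ u) (f v) (f′ v) (oneOf u v) disjoint-f disjoint-f
          (λ f′u f′v → independent′ (fixed⇒P′ f′u) (fixed⇒P′ f′v))

    -- A red pair u(π u) and a blue pair v(σ v) span at least two white pairs.
    square : X * Y ≤ 2 * K
    square = *-cancelˡ-≤ 2 (begin
      2 * (X * Y)                                                ≡⟨ trans (∑∑-*ˡ 2 _) (cong (2 *_) (∑∑-* (λ u → ⟦ not (f u) ⟧) (λ v → ⟦ not (f′ v) ⟧))) ⟨
      ∑∑ (λ u v → 2 * (⟦ not (f u) ⟧ * ⟦ not (f′ v) ⟧))          ≤⟨ ∑∑-mono pt ⟩
      ∑∑ (λ u v → (k u v + k u (σ v)) + (k (π u) v + k (π u) (σ v)))  ≡⟨ trans (∑∑-+ _ _) (cong₂ _+_ (∑∑-+ _ _) (∑∑-+ _ _)) ⟩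
      (K + ∑∑ (λ u v → k u (σ v))) + (∑∑ (λ u v → k (π u) v) + ∑∑ (λ u v → k (π u) (σ v)))
        ≡⟨ cong₂ _+_ (cong (K +_) onlyσ) (cong₂ _+_ onlyπ (trans (∑-injective π π-injective (λ u → ∑ λ v → k u (σ v))) onlyσ)) ⟩
      (K + K) + (K + K)                                          ≡⟨ four K ⟩
      2 * (2 * K)                                                ∎)
      where
      open ≤-Reasoning
      four : ∀ x → (x + x) + (x + x) ≡ 2 * (2 * x)
      four = solve-∀
      onlyσ : ∑∑ (λ u v → k u (σ v)) ≡ K
      onlyσ = ∑-cong (λ u → ∑-injective σ σ-injective (k u))
      onlyπ : ∑∑ (λ u v → k (π u) v) ≡ K
      onlyπ = ∑-injective π π-injective (λ u → ∑ (k u))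
      -- The rows `u` and `π u` are joined by red, the columns `v` and `σ v` by blue. A red entry
      -- makes the other entry of its row white, a blue entry the other one of its column.
      matrix : ∀ {r₁₁ b₁₁ w₁₁ r₁₂ b₁₂ w₁₂ r₂₁ b₂₁ w₂₁ r₂₂ b₂₂ w₂₂} →
        OneOf r₁₁ b₁₁ w₁₁ → OneOf r₁₂ b₁₂ w₁₂ → OneOf r₂₁ b₂₁ w₂₁ → OneOf r₂₂ b₂₂ w₂₂ →
        (r₁₁ ≡ true → w₁₂ ≡ true) → (r₁₂ ≡ true → w₁₁ ≡ true) → (r₂₁ ≡ true → w₂₂ ≡ true) → (r₂₂ ≡ true → w₂₁ ≡ true) →
        (b₁₁ ≡ true → w₂₁ ≡ true) → (b₂₁ ≡ true → w₁₁ ≡ true) → (b₁₂ ≡ true → w₂₂ ≡ true) → (b₂₂ ≡ true → w₁₂ ≡ true) →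
        2 ≤ (⟦ w₁₁ ⟧ + ⟦ w₁₂ ⟧) + (⟦ w₂₁ ⟧ + ⟦ w₂₂ ⟧)
      matrix {w₁₂ = x} {w₂₁ = y} one₃ _ _ one₃ _ _ _ _ _ _ _ _ = two x y
        where
        two : ∀ x y → 2 ≤ (1 + ⟦ x ⟧) + (⟦ y ⟧ + 1)
        two x y = +-mono-≤ (m≤m+n 1 ⟦ x ⟧) (m≤n+m 1 ⟦ y ⟧)
      matrix {w₁₂ = x} one₃ _ _ one₁ _ _ _ h _ _ _ _ rewrite h refl = +-mono-≤ (m≤m+n 1 ⟦ x ⟧) ≤-refl
      matrix {w₂₁ = y} one₃ _ _ one₂ _ _ _ _ _ _ _ h rewrite h refl = m≤m+n 2 (⟦ y ⟧ + 0)
      matrix one₁ _ one₁ _ h₁ _ h₂ _ _ _ _ _ rewrite h₁ refl | h₂ refl = ≤-refl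
      matrix one₁ _ one₂ _ _ _ _ _ _ h _ _ = contradiction (h refl) λ ()
      matrix {w₂₂ = z} one₁ _ one₃ _ h _ _ _ _ _ _ _ rewrite h refl = m≤m+n 2 ⟦ z ⟧
      matrix one₂ one₁ _ _ _ h _ _ _ _ _ _ = contradiction (h refl) λ ()
      matrix one₂ one₂ _ _ _ _ _ _ h₁ _ h₂ _ rewrite h₁ refl | h₂ refl = ≤-refl
      matrix {w₂₂ = z} one₂ one₃ _ _ _ _ _ _ h _ _ _ rewrite h refl = m≤m+n 2 ⟦ z ⟧
      pt : ∀ u v → 2 * (⟦ not (f u) ⟧ * ⟦ not (f′ v) ⟧) ≤ (k u v + k u (σ v)) + (k (π u) v + k (π u) (σ v))
      pt u v with f u in fu | f′ v in f′v
      ... | true  | _     = z≤n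
      ... | false | true  = z≤n
      ... | false | false rewrite trans (fixed-π u) fu | trans (fixed-σ v) f′v = ≤-trans
        (matrix (oneOf u v) (oneOf u (σ v)) (oneOf (π u) v) (oneOf (π u) (σ v))
          (λ h → RBW h vσ) (λ h → RBW h σv) (λ h → RBW h vσ) (λ h → RBW h σv)
          (λ h → RBW πu h) (λ h → RBW uπ h) (λ h → RBW πu h) (λ h → RBW uπ h))
        (≤-reflexive (unit (w u v) (w u (σ v)) (w (π u) v) (w (π u) (σ v))))
        where
        vσ : B v (σ v) ≡ true
        vσ = moved⇒adj′ f′v
        σv : B (σ v) v ≡ true
        σv = trans (B-sym (σ v) v) vσ
        uπ : R u (π u) ≡ true
        uπ = moved⇒adj fu
        πu : R (π u) u ≡ true
        πu = trans (R-sym (π u) u) uπ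
        unit : ∀ a b c d → (a + b) + (c + d) ≡ ((1 * (1 * a)) + (1 * (1 * b))) + ((1 * (1 * c)) + (1 * (1 * d)))
        unit = solve-∀

    -- `σ u` is a blue neighbour of `u` and again moved by `σ`. The arc therefore counts in `Bc`
    -- unless `σ u` is fixed by `π`, which happens at most `ρ` times by injectivity.
    blue-arcs : c ≤ Bc + ρ
    blue-arcs = begin
      c                                                        ≤⟨ ∑-mono pt ⟩
      ∑ (λ u → ∑ (bc u) + ⟦ f (σ u) ⟧)                         ≡⟨ ∑-+ _ _ ⟩
      Bc + ∑ (λ u → ⟦ f (σ u) ⟧)                               ≡⟨ cong (Bc +_) (∑-injective σ σ-injective (⟦_⟧ ∘ f)) ⟩
      Bc + ρ                                                   ∎
      where
      open ≤-Reasoning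
      bc : Fin n → Fin n → ℕ
      bc u v = ⟦ not (f u) ∧ not (f′ u) ⟧ * (⟦ not (f v) ∧ not (f′ v) ⟧ * b u v)
      at-σ : ∀ u → ⟦ not (f u) ∧ not (f′ u) ⟧ ≤ bc u (σ u) + ⟦ f (σ u) ⟧
      at-σ u with f u | f′ u in f′u
      ... | true  | _     = z≤n
      ... | false | true  = z≤n
      ... | false | false rewrite trans (fixed-σ u) f′u | moved⇒adj′ {u} f′u with f (σ u)
      ...   | true  = ≤-refl
      ...   | false = ≤-refl
      pt : ∀ u → ⟦ not (f u) ∧ not (f′ u) ⟧ ≤ ∑ (bc u) + ⟦ f (σ u) ⟧
      pt u = ≤-trans (at-σ u) (+-monoˡ-≤ ⟦ f (σ u) ⟧ (term≤∑ (bc u) (σ u)))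

    white-loops : ρ ≤ Fw
    white-loops = ∑-mono λ u → ≤-trans (at u) (term≤∑ (λ v → ⟦ f u ⟧ * (⟦ f v ⟧ * w u v)) u)
      where
      at : ∀ u → ⟦ f u ⟧ ≤ ⟦ f u ⟧ * (⟦ f u ⟧ * w u u)
      at u rewrite loop u with f u
      ... | true  = ≤-refl
      ... | false = z≤n

    partition : (c + ρ) + τ ≡ n
    partition = trans (cong (_+ τ) (sym (∑-+ _ _))) (trans (sym (∑-+ _ _)) (trans (∑-cong pt) (∑-one n)))
      where
      pt : ∀ v → (⟦ not (f v) ∧ not (f′ v) ⟧ + ⟦ f v ⟧) + ⟦ f′ v ⟧ ≡ 1
      pt v with f v in fv | f′ v in f′v
      ... | true  | true  = true≢false f′v (disjoint-f fv)
      ... | true  | false = refl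
      ... | false | true  = refl
      ... | false | false = refl

    -- The fixed points of `σ` avoid `P`, so they split into `t₁` inside `H` and `t₂` in the rest.
    -- The pairs in `e` are singled out because they are paid for by a bound on the full red degree
    -- of those `t₁` vertices.
    h h′ t₁ t₂ q e RF′₁ RF′₂ : ℕ
    h  = count H
    h′ = count λ v → H v ∧ not (f′ v)
    t₁ = count λ v → H v ∧ f′ v
    t₂ = count λ v → not (H v) ∧ f′ v
    q = count λ v → not (P v) ∧ not (H v)
    e  = ∑∑ λ u v → ⟦ H u ∧ f′ u ⟧ * (⟦ f v ⟧ * r u v)
    RF′₁ = ∑∑ λ u v → ⟦ H u ∧ f′ u ⟧ * (⟦ not (f v) ⟧ * r u v)
    RF′₂ = ∑∑ λ u v → ⟦ not (H u) ∧ f′ u ⟧ * (⟦ not (f v) ⟧ * r u v)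

    h≡ : t₁ + h′ ≡ h
    h≡ = count-split H f′

    τ≡ : t₁ + t₂ ≡ τ
    τ≡ = trans (sym (∑-+ _ _)) (∑-cong λ v → pt (H v) (f′ v))
      where
      pt : ∀ a b → ⟦ a ∧ b ⟧ + ⟦ not a ∧ b ⟧ ≡ ⟦ b ⟧
      pt true  b = +-identityʳ _
      pt false b = refl

    RF′≡ : RF′ ≡ RF′₁ + RF′₂
    RF′≡ = trans (∑∑-cong λ u v → pt (H u) (f′ u) (⟦ not (f v) ⟧ * r u v)) (∑∑-+ _ _)
      where
      pt : ∀ a b z → ⟦ b ⟧ * z ≡ ⟦ a ∧ b ⟧ * z + ⟦ not a ∧ b ⟧ * z
      pt true  b z = sym (+-identityʳ _)
      pt false b z = refl

    t₂≤q : t₂ ≤ q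
    t₂≤q = count-mono λ v h → let ¬Hv , f′v = ∧-elim {not (H v)} h in ∧-intro (not-intro (f′⇒¬P f′v)) ¬Hv

    ¬P≡ : count (not ∘ P) ≡ h + q
    ¬P≡ = trans (∑-cong pt) (∑-+ _ _)
      where
      pt : ∀ v → ⟦ not (P v) ⟧ ≡ ⟦ H v ⟧ + ⟦ not (P v) ∧ not (H v) ⟧
      pt v with P v in Pv | H v in Hv
      ... | true  | true  = true≢false Hv (P⇒¬H Pv)
      ... | true  | false = refl
      ... | false | true  = refl
      ... | false | false = refl

    -- `P` has `ρ` more elements than `H`, so removing `ρ` vertices leaves twice `h` plus the rest.
    X≡ : X ≡ 2 * h + q
    X≡ = +-cancelˡ-≡ ρ _ _ (trans (count-not f) (trans (sym (count-not P)) (trans (cong₂ _+_ count-P ¬P≡) (shuffle h ρ q))))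
      where
      shuffle : ∀ h ρ q → (h + ρ) + (h + q) ≡ ρ + (2 * h + q)
      shuffle = solve-∀

    -- The fixed points of `π` lie in `P` and see red only in `H`. Inside `H`, the vertices moved by
    -- `σ` are estimated by all possible pairs, the others are kept as `e`.
    RF≤ : RF ≤ ρ * h′ + e
    RF≤ = begin
      RF                                                   ≤⟨ ∑∑-mono pt ⟩
      ∑∑ (λ u v → ⟦ f u ⟧ * ⟦ H v ∧ not (f′ v) ⟧ + ⟦ H v ∧ f′ v ⟧ * (⟦ f u ⟧ * r v u))
                                                          ≡⟨ trans (∑∑-+ _ _) (cong₂ _+_ (∑∑-* (⟦_⟧ ∘ f) (λ v → ⟦ H v ∧ not (f′ v) ⟧))
                                                               (sym (∑-swap (λ v u → ⟦ H v ∧ f′ v ⟧ * (⟦ f u ⟧ * r v u))))) ⟩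
      ρ * h′ + e                                          ∎
      where
      open ≤-Reasoning
      pt : ∀ u v → ⟦ f u ⟧ * r u v ≤ ⟦ f u ⟧ * ⟦ H v ∧ not (f′ v) ⟧ + ⟦ H v ∧ f′ v ⟧ * (⟦ f u ⟧ * r v u)
      pt u v rewrite R-sym v u with f u in fu | R u v in uv
      ... | false | _     = z≤n
      ... | true  | false = z≤n
      ... | true  | true rewrite N-intro R P (fixed⇒P fu) uv with f′ v
      ...   | true  = ≤-refl
      ...   | false = ≤-refl

    -- Outside `H` a vertex has no red neighbour in `P`. It is itself one of the `h + q` vertices
    -- outside `P`, and its white loop accounts for the extra `t₂`.
    RF′₂≤ : RF′₂ + t₂ ≤ t₂ * (h + q)
    RF′₂≤ = begin
      RF′₂ + t₂                                              ≡⟨ ∑-+ _ _ ⟨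
      ∑ (λ u → ∑ (λ v → ⟦ s u ⟧ * (⟦ not (f v) ⟧ * r u v)) + ⟦ s u ⟧) ≤⟨ ∑-mono row ⟩
      ∑ (λ u → ⟦ s u ⟧ * count (not ∘ P))                  ≡⟨ ∑-*ʳ _ _ ⟩
      t₂ * count (not ∘ P)                                 ≡⟨ cong (t₂ *_) ¬P≡ ⟩
      t₂ * (h + q)                                        ∎
      where
      open ≤-Reasoning
      s : Fin n → Bool
      s u = not (H u) ∧ f′ u
      inner : ∀ u → H u ≡ false → P u ≡ false → ∑ (λ v → ⟦ not (f v) ⟧ * r u v) + 1 ≤ count (not ∘ P)
      inner u Hu Pu = begin
        ∑ (λ v → ⟦ not (f v) ⟧ * r u v) + 1                                        ≤⟨ +-monoʳ-≤ _ (≤-trans (≤-reflexive at-u) (term≤∑ (λ v → ⟦ not (P v) ⟧ * w u v) u)) ⟩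
        ∑ (λ v → ⟦ not (f v) ⟧ * r u v) + ∑ (λ v → ⟦ not (P v) ⟧ * w u v)          ≡⟨ ∑-+ _ _ ⟨
        ∑ (λ v → ⟦ not (f v) ⟧ * r u v + ⟦ not (P v) ⟧ * w u v)                    ≤⟨ ∑-mono pt ⟩
        count (not ∘ P)                                                            ∎
        where
        at-u : 1 ≡ ⟦ not (P u) ⟧ * w u u
        at-u rewrite Pu | loop u = refl
        pt : ∀ v → ⟦ not (f v) ⟧ * r u v + ⟦ not (P v) ⟧ * w u v ≤ ⟦ not (P v) ⟧
        pt v with P v in Pv
        ... | true with R u v in uv
        ...   | true  = true≢false (N-intro R P Pv (trans (R-sym v u) uv)) Hu
        ...   | false = ≤-reflexive (trans (+-identityʳ _) (*-zeroʳ ⟦ not (f v) ⟧))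
        pt v | false = ≤-trans (+-mono-≤ (*-monoˡ-≤ (r u v) (⟦⟧≤1 (not (f v)))) ≤-refl)
          (≤-trans (≤-reflexive (cong₂ _+_ (*-identityˡ (r u v)) (*-identityˡ (w u v)))) (r+w≤1 u v))
      row : ∀ u → ∑ (λ v → ⟦ s u ⟧ * (⟦ not (f v) ⟧ * r u v)) + ⟦ s u ⟧ ≤ ⟦ s u ⟧ * count (not ∘ P)
      row u with H u in Hu | f′ u in f′u
      ... | true  | _     = ≤-reflexive (cong (_+ 0) (∑-zero n))
      ... | false | false = ≤-reflexive (cong (_+ 0) (∑-zero n))
      ... | false | true  = ≤-trans (≤-reflexive (cong (_+ 1) (trans (∑-*ˡ 1 _) (*-identityˡ _))))
                              (≤-trans (inner u Hu (f′⇒¬P f′u)) (≤-reflexive (sym (*-identityˡ _))))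

    -- Adding `e` restores full red degrees. If `σ` moves `v`, at most one of `v` and `σ v` is a red
    -- neighbour of `u`, so `u` has at most `Y` / 2 red neighbours among the moved vertices; among
    -- the fixed ones it has at most `τ` - 1, because of its loop. Finally `Y + 2 * τ` is `n + τ`.
    RF′₁≤ : 2 * RF′₁ + 2 * e + 2 * t₁ ≤ t₁ * (n + τ)
    RF′₁≤ = begin
      2 * RF′₁ + 2 * e + 2 * t₁                                 ≡⟨ factor RF′₁ e t₁ ⟩
      2 * (RF′₁ + e + t₁)                                       ≡⟨ cong (2 *_) (trans (∑-+ _ _) (cong (_+ t₁) (∑-+ _ _))) ⟨
      2 * ∑ (λ u → ∑ (λ v → ⟦ s u ⟧ * (⟦ not (f v) ⟧ * r u v)) + ∑ (λ v → ⟦ s u ⟧ * (⟦ f v ⟧ * r u v)) + ⟦ s u ⟧)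
                                                              ≡⟨ cong (2 *_) (∑-cong row) ⟩
      2 * ∑ (λ u → ⟦ s u ⟧ * (∑ (r u) + 1))                   ≡⟨ ∑-*ˡ 2 _ ⟨
      ∑ (λ u → 2 * (⟦ s u ⟧ * (∑ (r u) + 1)))                 ≤⟨ ∑-mono bound ⟩
      ∑ (λ u → ⟦ s u ⟧ * (n + τ))                             ≡⟨ ∑-*ʳ _ _ ⟩
      t₁ * (n + τ)                                            ∎
      where
      open ≤-Reasoning
      s : Fin n → Bool
      s u = H u ∧ f′ u
      factor : ∀ a b c → 2 * a + 2 * b + 2 * c ≡ 2 * (a + b + c)
      factor = solve-∀
      row : ∀ u → ∑ (λ v → ⟦ s u ⟧ * (⟦ not (f v) ⟧ * r u v)) + ∑ (λ v → ⟦ s u ⟧ * (⟦ f v ⟧ * r u v)) + ⟦ s u ⟧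
                ≡ ⟦ s u ⟧ * (∑ (r u) + 1)
      row u = trans (cong₂ (λ a b → a + b + ⟦ s u ⟧) (∑-*ˡ ⟦ s u ⟧ _) (∑-*ˡ ⟦ s u ⟧ _))
        (trans (distrib ⟦ s u ⟧ (∑ (λ v → ⟦ not (f v) ⟧ * r u v)) (∑ (λ v → ⟦ f v ⟧ * r u v)))
          (cong (λ z → ⟦ s u ⟧ * (z + 1)) (trans (sym (∑-+ _ _)) (∑-cong λ v → pt (f v) (r u v)))))
        where
        distrib : ∀ s a b → s * a + s * b + s ≡ s * (a + b + 1)
        distrib = solve-∀
        pt : ∀ a z → ⟦ not a ⟧ * z + ⟦ a ⟧ * z ≡ z
        pt true  z = +-identityʳ z
        pt false z = trans (+-identityʳ (z + 0)) (+-identityʳ z)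
      half : ∀ u → 2 * ∑ (λ v → ⟦ not (f′ v) ⟧ * r u v) ≤ Y
      half u = begin
        2 * A                                                       ≡⟨ cong (A +_) (+-identityʳ A) ⟩
        A + A                                                       ≡⟨ cong (A +_) (∑-injective σ σ-injective (λ v → ⟦ not (f′ v) ⟧ * r u v)) ⟨
        A + ∑ (λ v → ⟦ not (f′ (σ v)) ⟧ * r u (σ v))                ≡⟨ ∑-+ _ _ ⟨
        ∑ (λ v → ⟦ not (f′ v) ⟧ * r u v + ⟦ not (f′ (σ v)) ⟧ * r u (σ v)) ≤⟨ ∑-mono pt ⟩
        Y                                                           ∎
        where
        A = ∑ (λ v → ⟦ not (f′ v) ⟧ * r u v)
        pt : ∀ v → ⟦ not (f′ v) ⟧ * r u v + ⟦ not (f′ (σ v)) ⟧ * r u (σ v) ≤ ⟦ not (f′ v) ⟧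
        pt v rewrite fixed-σ v with f′ v in f′v
        ... | true  = z≤n
        ... | false with R u v in uv
        ...   | false = ≤-trans (≤-reflexive (*-identityˡ (r u (σ v)))) (⟦⟧≤1 (R u (σ v)))
        ...   | true with R u (σ v) in uσ
        ...     | false = ≤-refl
        ...     | true  = true≢false (R-σ f′v uv) (R⇒¬W uσ)
      others : ∀ u → f′ u ≡ true → ∑ (λ v → ⟦ f′ v ⟧ * r u v) + 1 ≤ τ
      others u f′u = begin
        ∑ (λ v → ⟦ f′ v ⟧ * r u v) + 1                                  ≤⟨ +-monoʳ-≤ _ (≤-trans (≤-reflexive at-u) (term≤∑ (λ v → ⟦ f′ v ⟧ * w u v) u)) ⟩
        ∑ (λ v → ⟦ f′ v ⟧ * r u v) + ∑ (λ v → ⟦ f′ v ⟧ * w u v)         ≡⟨ ∑-+ _ _ ⟨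
        ∑ (λ v → ⟦ f′ v ⟧ * r u v + ⟦ f′ v ⟧ * w u v)                   ≤⟨ ∑-mono pt ⟩
        τ                                                               ∎
        where
        at-u : 1 ≡ ⟦ f′ u ⟧ * w u u
        at-u rewrite f′u | loop u = refl
        pt : ∀ v → ⟦ f′ v ⟧ * r u v + ⟦ f′ v ⟧ * w u v ≤ ⟦ f′ v ⟧
        pt v = ≤-trans (≤-reflexive (sym (*-distribˡ-+ ⟦ f′ v ⟧ (r u v) (w u v))))
          (≤-trans (*-monoʳ-≤ ⟦ f′ v ⟧ (r+w≤1 u v)) (≤-reflexive (*-identityʳ _)))
      degree : ∀ u → f′ u ≡ true → 2 * (∑ (r u) + 1) ≤ n + τ
      degree u f′u = begin
        2 * (∑ (r u) + 1)                          ≡⟨ cong (λ z → 2 * (z + 1)) (trans (∑-cong λ v → pt (f′ v) (r u v)) (∑-+ _ _)) ⟩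
        2 * ((A + D) + 1)                          ≡⟨ rearrange A D ⟩
        2 * A + 2 * (D + 1)                        ≤⟨ +-mono-≤ (half u) (*-monoʳ-≤ 2 (others u f′u)) ⟩
        Y + 2 * τ                                  ≡⟨ regroup Y τ ⟩
        (τ + Y) + τ                                ≡⟨ cong (_+ τ) (count-not f′) ⟩
        n + τ                                      ∎
        where
        A = ∑ (λ v → ⟦ not (f′ v) ⟧ * r u v)
        D = ∑ (λ v → ⟦ f′ v ⟧ * r u v)
        rearrange : ∀ a d → 2 * ((a + d) + 1) ≡ 2 * a + 2 * (d + 1)
        rearrange = solve-∀
        regroup : ∀ y t → y + 2 * t ≡ (t + y) + t
        regroup = solve-∀
        pt : ∀ a z → z ≡ ⟦ not a ⟧ * z + ⟦ a ⟧ * z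
        pt true  z = sym (+-identityʳ z)
        pt false z = sym (trans (+-identityʳ (z + 0)) (+-identityʳ z))
      bound : ∀ u → 2 * (⟦ s u ⟧ * (∑ (r u) + 1)) ≤ ⟦ s u ⟧ * (n + τ)
      bound u with H u | f′ u in f′u
      ... | false | _     = z≤n
      ... | true  | false = z≤n
      ... | true  | true  = ≤-trans (≤-reflexive (cong (2 *_) (*-identityˡ (∑ (r u) + 1))))
                              (≤-trans (degree u f′u) (≤-reflexive (sym (*-identityˡ _))))

    -- The comparison of the two numbers of fixed points enters here, as `ρ` written in the form
    -- `τ + δ`.
    RF+RF′≤ : 1 ≤ τ → τ ≤ ρ → 2 * (RF + RF′) + (ρ + τ) ≤ X * (ρ + τ)
    RF+RF′≤ 1≤τ τ≤ρ rewrite X≡ | RF′≡ with m≤n⇒∃[o]m+o≡n τ≤ρ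
    ... | δ , τ+δ≡ρ = subst (λ z → 2 * (RF + (RF′₁ + RF′₂)) + (z + τ) ≤ (2 * h + q) * (z + τ)) τ+δ≡ρ
      (subst₂ (λ x y → 2 * (RF + (RF′₁ + RF′₂)) + ((x + δ) + x) ≤ (2 * y + q) * ((x + δ) + x)) τ≡ h≡
        (final-arithmetic {h′} {t₁} {t₂} {q} {δ} {RF} {RF′₁} {RF′₂} {e} t₂≤q
          (≤-trans 1≤τ (≤-reflexive (sym τ≡)))
          (≤-trans RF≤ (≤-reflexive (cong (λ z → z * h′ + e) (sym ρ≡))))
          (≤-trans RF′₁≤ (≤-reflexive (cong (t₁ *_) (cong₂ _+_ n≡ (sym τ≡)))))
          (≤-trans RF′₂≤ (≤-reflexive (cong (λ z → t₂ * (z + q)) (sym h≡))))))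
      where
      ρ≡ : (t₁ + t₂) + δ ≡ ρ
      ρ≡ = trans (cong (_+ δ) τ≡) τ+δ≡ρ
      n≡ : n ≡ 2 * (t₁ + h′) + q + ((t₁ + t₂) + δ)
      n≡ = trans (sym (count-not f)) (trans (+-comm ρ X)
        (cong₂ _+_ (trans X≡ (cong (λ z → 2 * z + q) (sym h≡))) (sym ρ≡)))

    -- `square` absorbs `X * Y` into `2 * K`. The summand `n` is put together from `ρ + τ`, the
    -- slack in `RF+RF′≤`, and from `c`, supplied by `blue-arcs` and `white-loops`.
    few-fixed-σ : 1 ≤ τ → τ ≤ ρ → ∑∑ r + n ≤ ∑∑ w
    few-fixed-σ 1≤τ τ≤ρ = +-cancelʳ-≤ (2 * K + X * (ρ + τ) + ρ + 2 * (RF + RF′)) _ _ (begin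
      ∑∑ r + n + (2 * K + X * (ρ + τ) + ρ + 2 * (RF + RF′))
        ≡⟨ cong (λ z → ∑∑ r + z + (2 * K + X * (ρ + τ) + ρ + 2 * (RF + RF′))) partition ⟨
      ∑∑ r + ((c + ρ) + τ) + (2 * K + X * (ρ + τ) + ρ + 2 * (RF + RF′))
        ≡⟨ collect₁ (∑∑ r) c ρ τ (2 * K) (X * (ρ + τ)) (2 * (RF + RF′)) ⟩
      (∑∑ r + 2 * K + X * (ρ + τ)) + (c + ρ) + (2 * (RF + RF′) + (ρ + τ))
        ≤⟨ +-mono-≤ (+-monoʳ-≤ (∑∑ r + 2 * K + X * (ρ + τ)) (+-mono-≤ blue-arcs white-loops)) (RF+RF′≤ 1≤τ τ≤ρ) ⟩
      (∑∑ r + 2 * K + X * (ρ + τ)) + ((Bc + ρ) + Fw) + X * (ρ + τ)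
        ≡⟨ collect₂ (∑∑ r) (2 * K) Bc Fw ρ (X * (ρ + τ)) ⟩
      (∑∑ r + (2 * K + (Bc + (Fw + X * (ρ + τ))))) + (X * (ρ + τ) + ρ)
        ≤⟨ +-monoˡ-≤ _ summed ⟩
      (∑∑ w + (X * Y + 2 * (RF + RF′))) + (X * (ρ + τ) + ρ)
        ≤⟨ +-monoˡ-≤ _ (+-monoʳ-≤ (∑∑ w) (+-monoˡ-≤ _ square)) ⟩
      (∑∑ w + (2 * K + 2 * (RF + RF′))) + (X * (ρ + τ) + ρ)
        ≡⟨ collect₃ (∑∑ w) (2 * K) (2 * (RF + RF′)) (X * (ρ + τ)) ρ ⟩
      ∑∑ w + (2 * K + X * (ρ + τ) + ρ + 2 * (RF + RF′)) ∎)
      where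
      open ≤-Reasoning
      collect₁ : ∀ r c ρ τ K X RF → r + ((c + ρ) + τ) + (K + X + ρ + RF) ≡ (r + K + X) + (c + ρ) + (RF + (ρ + τ))
      collect₁ = solve-∀
      collect₂ : ∀ r K B F ρ X → (r + K + X) + ((B + ρ) + F) + X ≡ (r + (K + (B + (F + X)))) + (X + ρ)
      collect₂ = solve-∀
      collect₃ : ∀ w K RF X ρ → (w + (K + RF)) + (X + ρ) ≡ w + (K + X + ρ + RF)
      collect₃ = solve-∀

    conclusion : τ ≤ ρ → ∑∑ r + n ≤ ∑∑ w
    conclusion τ≤ρ with 1 ≤? τ
    ... | yes 1≤τ = few-fixed-σ 1≤τ τ≤ρ
    ... | no  τ<1 = no-fixed-σ (n<1⇒n≡0 (≰⇒> τ<1))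

-- Deleting a vertex, and the induction

low-degree : (G : Colouring n) (S : Barrier (Colouring.R G)) → let open Colouring G in
  ∀ {v} → Barrier.P S v ≡ true → ∑ (r v) < ∑ (w v)
low-degree G S {v} Pv = ≤-trans (surplus Pv) (count-mono white)
  where
  open Colouring G
  open Barrier S
  -- `v x` is not red since `P` is independent. It is not blue either: `v` and `x` have a common red
  -- neighbour `u`, and a blue `v x` would make `u x` white.
  white : ∀ x → singleton v x ∨ (P x ∧ N R (R v) x) ≡ true → W v x ≡ true
  white x h with singleton v x in eq
  ... | true = subst (λ z → W v z ≡ true) (singleton-≡ v x eq) (loop v)
  ... | false with ∧-elim {P x} h
  ...   | Px , Nx with N-elim R (R v) Nx | independent Pv Px | oneOf v x
  ...     | u , vu , ux | ¬vx | o with R v x | B v x in vx | W v x | o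
  ...       | _ | _ | _ | one₃ = refl
  ...       | _ | _ | _ | one₂ = true≢false (RBW (trans (R-sym u v) vu) vx) (R⇒¬W ux)

delete : Fin (suc n) → Colouring (suc n) → Colouring n
delete v G = record
  { R = λ i j → R (punchIn v i) (punchIn v j)
  ; B = λ i j → B (punchIn v i) (punchIn v j)
  ; W = λ i j → W (punchIn v i) (punchIn v j)
  ; oneOf = λ i j → oneOf _ _
  ; R-sym = λ i j → R-sym _ _
  ; B-sym = λ i j → B-sym _ _
  ; W-sym = λ i j → W-sym _ _
  ; loop = λ i → loop _
  ; RBW = RBW
  }
  where open Colouring G

∑∑-remove : ∀ v (f : Fin (suc n) → Fin (suc n) → ℕ) → (∀ i j → f i j ≡ f j i) →
  ∑∑ f + f v v ≡ 2 * ∑ (f v) + ∑∑ (λ i j → f (punchIn v i) (punchIn v j))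
∑∑-remove {n} v f f-sym = trans (cong (_+ f v v) (trans (∑-remove v _) (cong (∑ (f v) +_)
    (trans (∑-cong (λ i → ∑-remove v (f (punchIn v i)))) (∑-+ _ _)))))
  (trans (shuffle (∑ (f v)) _ _ _) (cong (λ z → ∑ (f v) + z + D)
    (trans (cong (f v v +_) (∑-cong (λ i → f-sym (punchIn v i) v))) (trans (sym (∑-remove v (f v))) (sym (+-identityʳ _))))))
  where
  D = ∑∑ (λ i j → f (punchIn v i) (punchIn v j))
  shuffle : ∀ a b c d → a + (b + c) + d ≡ a + (d + b) + c
  shuffle = solve-∀

-- Row and column of `v` together yield two units from the strict inequality. One raises `n` to
-- `suc n`, the other pays for the white loop, which `2 * ∑ (w v)` counts twice.
undelete : (G : Colouring (suc n)) (v : Fin (suc n)) → let open Colouring G in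
  ∑ (r v) < ∑ (w v) → ∑∑ (Colouring.r (delete v G)) + n ≤ ∑∑ (Colouring.w (delete v G)) → ∑∑ r + suc n ≤ ∑∑ w
undelete {n} G v rv<wv le = +-cancelʳ-≤ 1 _ _ (begin
  ∑∑ r + suc n + 1                              ≡⟨ shuffle (∑∑ r) n ⟩
  ∑∑ r + 0 + (n + 2)                            ≡⟨ cong (λ z → ∑∑ r + z + (n + 2)) (cong ⟦_⟧ Rvv) ⟨
  ∑∑ r + r v v + (n + 2)                        ≡⟨ cong (_+ (n + 2)) (∑∑-remove v r (λ i j → cong ⟦_⟧ (R-sym i j))) ⟩
  2 * ∑ (r v) + ∑∑ (Colouring.r G′) + (n + 2)   ≡⟨ regroup (∑ (r v)) (∑∑ (Colouring.r G′)) n ⟩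
  2 * suc (∑ (r v)) + (∑∑ (Colouring.r G′) + n) ≤⟨ +-mono-≤ (*-monoʳ-≤ 2 rv<wv) le ⟩
  2 * ∑ (w v) + ∑∑ (Colouring.w G′)             ≡⟨ ∑∑-remove v w (λ i j → cong ⟦_⟧ (W-sym i j)) ⟨
  ∑∑ w + w v v                                  ≡⟨ cong (λ z → ∑∑ w + ⟦ z ⟧) (loop v) ⟩
  ∑∑ w + 1                                      ∎)
  where
  open ≤-Reasoning
  open Colouring G
  G′ = delete v G
  Rvv : R v v ≡ false
  Rvv = ¬true λ vv → true≢false (loop v) (R⇒¬W vv)
  shuffle : ∀ a n → a + suc n + 1 ≡ a + 0 + (n + 2)
  shuffle = solve-∀
  regroup : ∀ a b n → 2 * a + b + (n + 2) ≡ 2 * suc a + (b + n)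
  regroup = solve-∀

-- The loop is white, so strictness here means a weak inequality for proper neighbours. Both colours
-- are required because the induction hypothesis does not say which of them it bounds.
Removable : (G : Colouring n) → Fin n → Set
Removable G v = ∑ (r v) < ∑ (w v) × ∑ (b v) < ∑ (w v)
  where open Colouring G

irreducible : (G : Colouring n) → ¬ ∃ (Removable G) → let open Colouring G in
  ∑∑ r + n ≤ ∑∑ w ⊎ ∑∑ b + n ≤ ∑∑ w
irreducible {n} G none = compare (barrier R R-sym) (barrier B B-sym)
  where
  open Colouring G
  compare : Barrier R → Barrier B → ∑∑ r + n ≤ ∑∑ w ⊎ ∑∑ b + n ≤ ∑∑ w
  compare SR SB with ≤-total (Count.τ G SR SB) (Count.ρ G SR SB)
  -- A vertex of `P` fixed by `σ` would be removable: its red degree is low by membership in `P`,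
  -- its blue degree because fixed points of `σ` lie in the blue barrier.
  ... | inj₁ τ≤ρ = inj₁ (Count.conclusion G SR SB (λ f′v → ¬true λ Pv → none (_ ,
          low-degree G SR Pv ,
          low-degree (swap G) SB (Fixed.fixed⇒P (Count.B-irrefl G SR SB) SB f′v))) τ≤ρ)
  ... | inj₂ ρ≤τ = inj₂ (Count.conclusion (swap G) SB SR (λ fv → ¬true λ P′v → none (_ ,
          low-degree G SR (Fixed.fixed⇒P (Count.R-irrefl G SR SB) SR fv) ,
          low-degree (swap G) SB P′v)) ρ≤τ)

-- Over ordered pairs `∑∑ r` is twice the number of red edges, while `∑∑ w` is twice the number of
-- non-edges plus `n` loops; the summand `n` offsets the loops.
white-dominates : ∀ n (G : Colouring n) → let open Colouring G in
  ∑∑ r + n ≤ ∑∑ w ⊎ ∑∑ b + n ≤ ∑∑ w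
white-dominates zero    G = irreducible G λ ()
white-dominates (suc n) G with any? (λ v → ∑ (Colouring.r G v) <? ∑ (Colouring.w G v) ×-dec ∑ (Colouring.b G v) <? ∑ (Colouring.w G v))
... | no  none = irreducible G none
... | yes (v , rv<wv , bv<wv) with white-dominates n (delete v G)
...   | inj₁ le = inj₁ (undelete G v rv<wv le)
...   | inj₂ le = inj₂ (undelete (swap G) v bv<wv le)

-- Edge counts as double sums

∑-suc : (f : Fin (suc n) → ℕ) → ∑ f ≡ f zero + ∑ (f ∘ suc)
∑-suc f = ∑-remove zero f

∑-empty : (f : Fin 0 → ℕ) → ∑ f ≡ 0
∑-empty f = trans (∑-cong (λ ())) (∑-zero 0)

length-filter-map-filter : ∀ {A B : Set} {P : B → Set} {Q : A → Set} (P? : Decidable P) (Q? : Decidable Q)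
  (h : A → B) (f : Fin n → A) → length (filter P? (List.map h (filter Q? (tabulate f))))
  ≡ ∑ λ i → ⟦ does (Q? (f i)) ∧ does (P? (h (f i))) ⟧
length-filter-map-filter {zero}  P? Q? h f = sym (∑-empty _)
length-filter-map-filter {suc n} P? Q? h f = trans step (sym (∑-suc _))
  where
  tail = length-filter-map-filter P? Q? h (f ∘ suc)
  step : length (filter P? (List.map h (filter Q? (tabulate f))))
           ≡ ⟦ does (Q? (f zero)) ∧ does (P? (h (f zero))) ⟧
           + ∑ (λ i → ⟦ does (Q? (f (suc i))) ∧ does (P? (h (f (suc i)))) ⟧)
  step with does (Q? (f zero))
  ... | false = tail
  ... | true with does (P? (h (f zero)))
  ...   | false = tail
  ...   | true  = cong suc tail

length-filter-concatMap : ∀ {A B : Set} {P : B → Set} (P? : Decidable P) (g : A → List B) (f : Fin n → A) →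
  length (filter P? (concatMap g (tabulate f))) ≡ ∑ λ i → length (filter P? (g (f i)))
length-filter-concatMap {zero}  P? g f = sym (∑-empty _)
length-filter-concatMap {suc n} P? g f = trans
  (trans (cong length (filter-++ P? (g (f zero)) _)) (trans (length-++ (filter P? (g (f zero))))
    (cong (length (filter P? (g (f zero))) +_) (length-filter-concatMap P? g (f ∘ suc)))))
  (sym (∑-suc _))

edgeCount-∑∑ : (A : Fin n → Fin n → Bool) → edgeCount A ≡ ∑∑ λ u v → ⟦ does (u <ᶠ? v) ∧ A u v ⟧
edgeCount-∑∑ {n} A = trans (length-filter-concatMap _ _ (λ u → u)) (∑-cong λ u →
  trans (length-filter-map-filter _ (u <ᶠ?_) (u ,_) (λ v → v))
    (∑-cong λ v → cong (λ z → ⟦ does (u <ᶠ? v) ∧ z ⟧) (does-≟true (A u v))))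
  where
  does-≟true : ∀ a → does (a ≟ᵇ true) ≡ a
  does-≟true true  = refl
  does-≟true false = refl

∑∑≡2*edgeCount : (A : Fin n → Fin n → Bool) → (∀ u v → A u v ≡ A v u) → (∀ v → A v v ≡ false) →
  ∑∑ (λ u v → ⟦ A u v ⟧) ≡ 2 * edgeCount A
∑∑≡2*edgeCount A A-sym A-irrefl = trans (∑∑-cong pt) (trans (∑∑-+ up (flip up))
  (cong₂ _+_ (sym (edgeCount-∑∑ A))
    (trans (sym (∑-swap up)) (trans (sym (edgeCount-∑∑ A)) (sym (+-identityʳ _))))))
  where
  up : Fin _ → Fin _ → ℕ
  up u v = ⟦ does (u <ᶠ? v) ∧ A u v ⟧
  pt : ∀ u v → ⟦ A u v ⟧ ≡ up u v + up v u
  pt u v with <ᶠ-cmp u v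
  ... | tri< u<v _ v≮u rewrite dec-true (u <ᶠ? v) u<v | dec-false (v <ᶠ? u) v≮u = sym (+-identityʳ _)
  ... | tri> u≮v _ v<u rewrite dec-false (u <ᶠ? v) u≮v | dec-true (v <ᶠ? u) v<u = cong ⟦_⟧ (A-sym u v)
  ... | tri≈ u≮u refl _ rewrite dec-false (u <ᶠ? u) u≮u = cong ⟦_⟧ (A-irrefl u)

2*nC2 : ∀ n → 2 * (n C 2) + n ≡ n * n
2*nC2 zero    = refl
2*nC2 (suc n) = begin
  2 * (suc n C 2) + suc n        ≡⟨ cong (λ z → 2 * z + suc n) (nCk+nC[k+1]≡[n+1]C[k+1] n 1) ⟨
  2 * (n C 1 + n C 2) + suc n    ≡⟨ cong (λ z → 2 * (z + n C 2) + suc n) (nC1≡n n) ⟩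
  2 * (n + n C 2) + suc n        ≡⟨ shuffle n (n C 2) ⟩
  (2 * (n C 2) + n) + (2 * n + 1) ≡⟨ cong (_+ (2 * n + 1)) (2*nC2 n) ⟩
  n * n + (2 * n + 1)            ≡⟨ square n ⟩
  suc n * suc n                  ∎
  where
  open ≡-Reasoning
  shuffle : ∀ n c → 2 * (n + c) + suc n ≡ (2 * c + n) + (2 * n + 1)
  shuffle = solve-∀
  square : ∀ n → n * n + (2 * n + 1) ≡ suc n * suc n
  square = solve-∀

-- From coloured graphs to colourings

module _ (G : TwoColouredGraph n) where

  -- In a non-monochromatic triangle some vertex, here `b`, meets both colours. Excluding this one
  -- shape is exactly what `RBW` asks for.
  BadTriple : Fin n → Fin n → Fin n → Set
  BadTriple a b c = E₁ G a b ≡ true × E₂ G b c ≡ true × E G a c ≡ true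

  badTriple⇒triangle : ∀ {a b c} → BadTriple a b c → NonMonoTriangle G
  badTriple⇒triangle {a} {b} {c} (ab , bc , ac) = a , b , c , left ab , right (E₁ G b c) bc , ac , left ab ,
    right (E₂ G a b) (left bc)
    where
    left : ∀ {x y} → x ≡ true → x ∨ y ≡ true
    left refl = refl
    right : ∀ x {y} → y ≡ true → x ∨ y ≡ true
    right true  _    = refl
    right false refl = refl

  badTriple? : Dec (∃ λ a → ∃ λ b → ∃ λ c → BadTriple a b c)
  badTriple? = any? λ a → any? λ b → any? λ c →
    E₁ G a b ≟ᵇ true ×-dec E₂ G b c ≟ᵇ true ×-dec E G a c ≟ᵇ true

  colouring : ¬ (∃ λ a → ∃ λ b → ∃ λ c → BadTriple a b c) → Colouring n
  colouring none = record
    { R = E₁ G ; B = E₂ G ; W = λ u v → not (E G u v)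
    ; oneOf = λ u v → one (E₁ G u v) (E₂ G u v) (disjoint G u v)
    ; R-sym = sym₁ G ; B-sym = sym₂ G
    ; W-sym = λ u v → cong₂ (λ x y → not (x ∨ y)) (sym₁ G u v) (sym₂ G u v)
    ; loop = λ v → cong₂ (λ x y → not (x ∨ y)) (irrefl₁ G v) (irrefl₂ G v)
    ; RBW = λ {a} {b} {c} ab bc → not-intro (¬true λ ac → none (a , b , c , ab , bc , ac))
    }
    where
    one : ∀ x y → ¬ (x ≡ true × y ≡ true) → OneOf x y (not (x ∨ y))
    one true  true  d = ⊥-elim (d (refl , refl))
    one true  false d = one₁
    one false true  d = one₂
    one false false d = one₃

-- `x` is the number of white ordered pairs: a second copy of `e₁` fits into the place of the
-- non-edges.
bound-edges : ∀ n e₁ e₂ {x} → 2 * e₁ + n ≤ x → 2 * e₁ + 2 * e₂ + x ≡ n * n → (e₁ + e₂) + e₁ ≤ n C 2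
bound-edges n e₁ e₂ {x} le total = *-cancelˡ-≤ 2 (+-cancelʳ-≤ n _ _ (begin
  2 * ((e₁ + e₂) + e₁) + n          ≡⟨ shuffle e₁ e₂ n ⟩
  2 * e₁ + 2 * e₂ + (2 * e₁ + n)    ≤⟨ +-monoʳ-≤ (2 * e₁ + 2 * e₂) le ⟩
  2 * e₁ + 2 * e₂ + x               ≡⟨ total ⟩
  n * n                             ≡⟨ 2*nC2 n ⟨
  2 * (n C 2) + n                   ∎))
  where
  open ≤-Reasoning
  shuffle : ∀ a b n → 2 * ((a + b) + a) + n ≡ 2 * a + 2 * b + (2 * a + n)
  shuffle = solve-∀

theorem1p2 : (n : ℕ) (G : TwoColouredGraph n) →
    edgeCount (E G) + min (edgeCount (E₁ G)) (edgeCount (E₂ G)) > n C 2 →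
    NonMonoTriangle G
theorem1p2 n G many with badTriple? G
... | yes (_ , _ , _ , bad) = badTriple⇒triangle G bad
... | no  none = ⊥-elim (<-irrefl refl (<-≤-trans many (few (white-dominates n H))))
  where
  H = colouring G none
  open Colouring H using (r; b; w; oneOf)
  e₁ = edgeCount (E₁ G)
  e₂ = edgeCount (E₂ G)
  r≡ : ∑∑ r ≡ 2 * e₁
  r≡ = ∑∑≡2*edgeCount (E₁ G) (sym₁ G) (irrefl₁ G)
  b≡ : ∑∑ b ≡ 2 * e₂
  b≡ = ∑∑≡2*edgeCount (E₂ G) (sym₂ G) (irrefl₂ G)
  E≡ : edgeCount (E G) ≡ e₁ + e₂
  E≡ = trans (edgeCount-∑∑ (E G)) (trans (∑∑-cong λ u v → pt (does (u <ᶠ? v)) (oneOf u v))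
    (trans (∑∑-+ _ _) (cong₂ _+_ (sym (edgeCount-∑∑ (E₁ G))) (sym (edgeCount-∑∑ (E₂ G))))))
    where
    pt : ∀ z {x y t} → OneOf x y t → ⟦ z ∧ (x ∨ y) ⟧ ≡ ⟦ z ∧ x ⟧ + ⟦ z ∧ y ⟧
    pt false _    = refl
    pt true  one₁ = refl
    pt true  one₂ = refl
    pt true  one₃ = refl
  total : 2 * e₁ + 2 * e₂ + ∑∑ w ≡ n * n
  total = trans (cong (_+ ∑∑ w) (cong₂ _+_ (sym r≡) (sym b≡)))
    (trans (cong (_+ ∑∑ w) (sym (∑∑-+ r b))) (trans (sym (∑∑-+ _ w)) (trans (∑∑-cong λ u v → pt (oneOf u v))
      (trans (∑∑-* (λ _ → 1) (λ _ → 1)) (cong₂ _*_ (∑-one n) (∑-one n))))))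
    where
    pt : ∀ {x y t} → OneOf x y t → ⟦ x ⟧ + ⟦ y ⟧ + ⟦ t ⟧ ≡ 1 * 1
    pt one₁ = refl
    pt one₂ = refl
    pt one₃ = refl
  few : ∑∑ r + n ≤ ∑∑ w ⊎ ∑∑ b + n ≤ ∑∑ w → edgeCount (E G) + min e₁ e₂ ≤ n C 2
  few (inj₁ le) rewrite E≡ = ≤-trans (+-monoʳ-≤ (e₁ + e₂) (m⊓n≤m e₁ e₂))
    (bound-edges n e₁ e₂ (subst (λ z → z + n ≤ ∑∑ w) r≡ le) total)
  few (inj₂ le) rewrite E≡ | +-comm e₁ e₂ = ≤-trans (+-monoʳ-≤ (e₂ + e₁) (m⊓n≤n e₁ e₂))
    (bound-edges n e₂ e₁ (subst (λ z → z + n ≤ ∑∑ w) b≡ le) (trans (cong (_+ ∑∑ w) (+-comm (2 * e₂) (2 * e₁))) total))
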